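{- There is an absolute constant $K>0$ such that for every $n\ge 1$ and every total Boolean function $f:\{0,1\}^n\to\{0,1\}$, $$\mathrm{EC}(f)\le R_0(f)\le K\cdot \mathrm{EC}(f)^2 .$$
   Context: Let $f:\{0,1\}^n\to\{0,1\}$ and $[n]=\{1,\dots,n\}$. Query model: a randomized query algorithm $\mathcal A$ is given query access to $x\in\{0,1\}^n$ and a random string $r$; with one query it learns one bit $x_i$ of its choice (adaptively), and finally it outputs a bit $\mathcal A(x,r)$. $C(\mathcal A,x,r)$ denotes the number of queries made on $x$ with randomness $r$. (Equivalently, a randomized algorithm is a probability distribution over deterministic decision trees.) The zero-error randomized query complexity is $R_0(f)=\min_{\mathcal A}\max_x \mathbb E_r[C(\mathcal A,x,r)]$, over randomized query algorithms $\mathcal A$ with $\Pr_r[\mathcal A(x,r)=f(x)]=1$ for all $x\in\{0,1\}^n$. The expectational certificate complexity $\mathrm{EC}(f)$ is the optimal value of the following program over families $\{w_x\}_{x\in\{0,1\}^n}$, $w_x\in\mathbb R^n$: minimize $\max_{x}\sum_{i=1}^n w_x(i)$ subject to $\sum_{i:x_i\ne y_i} w_x(i)w_y(i)\ge 1$ for all $x,y$ with $f(x)\ne f(y)$, and $0\le w_x(i)\le 1$ for all $x\in\{0,1\}^n$, $i\in[n]$. -}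

module Defs where

open import Level using (Level; 0ℓ) renaming (_⊔_ to _⊔ˡ_; suc to lsuc)
open import Data.Bool.Base using (Bool; true; false; if_then_else_)
import Data.Bool.Properties as Bool
open import Data.Empty using (⊥-elim)
open import Data.Fin.Base using (Fin; zero; suc)
open import Data.Integer.Base using (+_)
open import Data.Nat.Base as ℕ using (ℕ; zero; suc)
open import Data.Product.Base using (Σ-syntax; ∃-syntax; _×_; _,_)
open import Data.Rational.Base as ℚ using (ℚ; 0ℚ; 1ℚ)
import Data.Rational.Properties as ℚ
open import Data.Sum.Base using (inj₁; inj₂)
open import Data.Vec.Base using (Vec; []; _∷_; lookup; allFin)
  renaming (map to mapᵛ)
open import Data.Vec.Properties using (map-lookup-allFin)
open import Data.Vec.Functional using (foldr)
open import Relation.Binary.PropositionalEquality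
  using (_≡_; _≢_; refl; trans; cong; subst)
open import Relation.Nullary using (yes; no; does)

private variable
  a b ℓ : Level

------------------------------------------------------------------------
-- Nonnegative real numbers

-- A nonnegative real x is given by its open upper cut { q ∈ ℚ ∣ x < q }.
-- Classically these cuts are exactly the reals x ≥ 0.  Every real quantity
-- below is nonnegative, and one-sided cuts have infima of arbitrary
-- inhabited families without any appeal to choice or excluded middle.  The
-- level ℓ is bookkeeping: classically ℝ≥0 0ℓ already contains every real,
-- and infima over large families merely land in a higher level.

record ℝ≥0 (ℓ : Level) : Set (lsuc ℓ) where
  field
    cut       : ℚ → Set ℓ
    inhabited : ∃[ q ] cut q
    positive  : ∀ {q} → cut q → 0ℚ ℚ.< q
    upward    : ∀ {p q} → p ℚ.≤ q → cut p → cut q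
    rounded   : ∀ {q} → cut q → ∃[ p ] (p ℚ.< q × cut p)

open ℝ≥0 public

infix  4 _≤_ _<_ _≈_
infixl 6 _+_ _⊔_
infixl 7 _*_

_≤_ : ℝ≥0 a → ℝ≥0 b → Set (a ⊔ˡ b)
x ≤ y = ∀ {q} → cut y q → cut x q

_≈_ : ℝ≥0 a → ℝ≥0 b → Set (a ⊔ˡ b)
x ≈ y = x ≤ y × y ≤ x

fromℚ : (r : ℚ) → .{{ℚ.NonNegative r}} → ℝ≥0 0ℓ
fromℚ r .cut q = r ℚ.< q
fromℚ r .inhabited =
  r ℚ.+ 1ℚ , subst (ℚ._< r ℚ.+ 1ℚ) (ℚ.+-identityʳ r)
               (ℚ.+-monoʳ-< r (ℚ.positive⁻¹ 1ℚ))
fromℚ r .positive r<q = ℚ.≤-<-trans (ℚ.nonNegative⁻¹ r) r<q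
fromℚ r .upward p≤q r<p = ℚ.<-≤-trans r<p p≤q
fromℚ r .rounded r<q with p , r<p , p<q ← ℚ.<-dense r<q = p , p<q , r<p

-- x < y iff x < r ≤ y for some rational r.
_<_ : ℝ≥0 a → ℝ≥0 b → Set (a ⊔ˡ b)
x < y = ∃[ r ] (cut x r × (∀ {q} → cut y q → r ℚ.< q))

fromℕ : ℕ → ℝ≥0 0ℓ
fromℕ k = fromℚ (+ k ℚ./ 1) {{ℚ.normalize-nonNeg k 1}}

0ℝ 1ℝ : ℝ≥0 0ℓ
0ℝ = fromℚ 0ℚ
1ℝ = fromℚ 1ℚ

_+_ : ℝ≥0 a → ℝ≥0 b → ℝ≥0 (a ⊔ˡ b)
(x + y) .cut q = ∃[ r ] ∃[ s ] (cut x r × cut y s × r ℚ.+ s ℚ.≤ q)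
(x + y) .inhabited with r , xr ← x .inhabited | s , ys ← y .inhabited =
  r ℚ.+ s , r , s , xr , ys , ℚ.≤-refl
(x + y) .positive (r , s , xr , ys , r+s≤q) =
  ℚ.<-≤-trans (ℚ.+-mono-< (positive x xr) (positive y ys)) r+s≤q
(x + y) .upward p≤q (r , s , xr , ys , r+s≤p) =
  r , s , xr , ys , ℚ.≤-trans r+s≤p p≤q
(x + y) .rounded (r , s , xr , ys , r+s≤q)
  with r′ , r′<r , xr′ ← x .rounded xr =
  r′ ℚ.+ s , ℚ.<-≤-trans (ℚ.+-monoˡ-< s r′<r) r+s≤q
  , r′ , s , xr′ , ys , ℚ.≤-refl

_*_ : ℝ≥0 a → ℝ≥0 b → ℝ≥0 (a ⊔ˡ b)
(x * y) .cut q = ∃[ r ] ∃[ s ] (cut x r × cut y s × r ℚ.* s ℚ.≤ q)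
(x * y) .inhabited with r , xr ← x .inhabited | s , ys ← y .inhabited =
  r ℚ.* s , r , s , xr , ys , ℚ.≤-refl
(x * y) .positive (r , s , xr , ys , rs≤q) =
  ℚ.<-≤-trans (ℚ.positive⁻¹ (r ℚ.* s) {{ℚ.pos*pos⇒pos r s}}) rs≤q
  where instance
    r-pos = ℚ.positive (positive x xr)
    s-pos = ℚ.positive (positive y ys)
(x * y) .upward p≤q (r , s , xr , ys , rs≤p) =
  r , s , xr , ys , ℚ.≤-trans rs≤p p≤q
(x * y) .rounded (r , s , xr , ys , rs≤q)
  with r′ , r′<r , xr′ ← x .rounded xr =
  r′ ℚ.* s
  , ℚ.<-≤-trans (ℚ.*-monoˡ-<-pos s {{ℚ.positive (positive y ys)}} r′<r) rs≤q
  , r′ , s , xr′ , ys , ℚ.≤-refl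

_⊔_ : ℝ≥0 a → ℝ≥0 b → ℝ≥0 (a ⊔ˡ b)
(x ⊔ y) .cut q = cut x q × cut y q
(x ⊔ y) .inhabited with r , xr ← x .inhabited | s , ys ← y .inhabited =
  r ℚ.⊔ s , upward x (ℚ.p≤p⊔q r s) xr , upward y (ℚ.p≤q⊔p r s) ys
(x ⊔ y) .positive (xq , _) = positive x xq
(x ⊔ y) .upward p≤q (xp , yp) = upward x p≤q xp , upward y p≤q yp
(x ⊔ y) .rounded (xq , yq)
  with r , r<q , xr ← x .rounded xq | s , s<q , ys ← y .rounded yq
  with ℚ.≤-total r s
... | inj₁ r≤s = s , s<q , upward x r≤s xr , ys
... | inj₂ s≤r = r , r<q , xr , upward y s≤r ys

inf : (I : Set a) → I → (I → ℝ≥0 b) → ℝ≥0 (a ⊔ˡ b)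
inf I i₀ v .cut q = Σ[ i ∈ I ] cut (v i) q
inf I i₀ v .inhabited with q , vq ← v i₀ .inhabited = q , i₀ , vq
inf I i₀ v .positive (i , vq) = positive (v i) vq
inf I i₀ v .upward p≤q (i , vp) = i , upward (v i) p≤q vp
inf I i₀ v .rounded (i , vq) with p , p<q , vp ← v i .rounded vq =
  p , p<q , i , vp

sum : ∀ {n} → (Fin n → ℝ≥0 0ℓ) → ℝ≥0 0ℓ
sum = foldr _+_ 0ℝ

------------------------------------------------------------------------
-- Boolean functions

Cube : ℕ → Set
Cube n = Vec Bool n

BooleanFunction : ℕ → Set
BooleanFunction n = Cube n → Bool

maxOverCube : ∀ {n} → (Cube n → ℝ≥0 ℓ) → ℝ≥0 ℓ
maxOverCube {n = zero}  v = v []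
maxOverCube {n = suc n} v =
  maxOverCube (λ x → v (false ∷ x)) ⊔ maxOverCube (λ x → v (true ∷ x))

------------------------------------------------------------------------
-- Expectational certificate complexity

sumWhereDiffer : ∀ {n} → Cube n → Cube n → (Fin n → ℝ≥0 0ℓ) → ℝ≥0 0ℓ
sumWhereDiffer x y t =
  sum λ i → if does (lookup x i Bool.≟ lookup y i) then 0ℝ else t i

-- The constraint 0 ≤ w x i is built into ℝ≥0.
record FeasibleWeights {n} (f : BooleanFunction n) : Set₁ where
  field
    w           : Cube n → Fin n → ℝ≥0 0ℓ
    w≤1         : ∀ x i → w x i ≤ 1ℝ
    intersects  : ∀ x y → f x ≢ f y →
                  1ℝ ≤ sumWhereDiffer x y (λ i → w x i * w y i)

weightValue : ∀ {n} {f : BooleanFunction n} → FeasibleWeights f → ℝ≥0 0ℓ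
weightValue W = maxOverCube λ x → sum (FeasibleWeights.w W x)

1≤1*1 : 1ℝ ≤ 1ℝ * 1ℝ
1≤1*1 (r , s , 1<r , 1<s , rs≤q) =
  ℚ.<-≤-trans (ℚ.<-trans 1<s s<rs) rs≤q
  where
  instance s-pos = ℚ.positive (positive 1ℝ 1<s)
  s<rs : s ℚ.< r ℚ.* s
  s<rs = subst (ℚ._< r ℚ.* s) (ℚ.*-identityˡ s) (ℚ.*-monoˡ-<-pos s 1<r)

x≤x+y : (x : ℝ≥0 a) (y : ℝ≥0 b) → x ≤ x + y
x≤x+y x y {q} (r , s , xr , ys , r+s≤q) = upward x (ℚ.≤-trans r≤r+s r+s≤q) xr
  where
  r≤r+s : r ℚ.≤ r ℚ.+ s
  r≤r+s = subst (ℚ._≤ r ℚ.+ s) (ℚ.+-identityʳ r)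
            (ℚ.+-monoʳ-≤ r (ℚ.<⇒≤ (positive y ys)))

y≤x+y : (x : ℝ≥0 a) (y : ℝ≥0 b) → y ≤ x + y
y≤x+y x y {q} (r , s , xr , ys , r+s≤q) = upward y (ℚ.≤-trans s≤r+s r+s≤q) ys
  where
  s≤r+s : s ℚ.≤ r ℚ.+ s
  s≤r+s = subst (ℚ._≤ r ℚ.+ s) (ℚ.+-identityˡ s)
            (ℚ.+-monoˡ-≤ s (ℚ.<⇒≤ (positive x xr)))

differ⇒1≤ : ∀ {n} (x y : Cube n) → x ≢ y →
            1ℝ ≤ sumWhereDiffer x y (λ _ → 1ℝ * 1ℝ)
differ⇒1≤ [] [] x≢y = ⊥-elim (x≢y refl)
differ⇒1≤ (c ∷ x) (d ∷ y) x≢y {q} h with c Bool.≟ d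
... | yes refl = differ⇒1≤ x y (λ x≡y → x≢y (cong (c ∷_) x≡y)) {q}
                   (y≤x+y 0ℝ (sumWhereDiffer x y λ _ → 1ℝ * 1ℝ) h)
... | no _     = 1≤1*1 (x≤x+y (1ℝ * 1ℝ) (sumWhereDiffer x y λ _ → 1ℝ * 1ℝ) h)

allOnes : ∀ {n} (f : BooleanFunction n) → FeasibleWeights f
allOnes f = record
  { w          = λ _ _ → 1ℝ
  ; w≤1        = λ _ _ h → h
  ; intersects = λ x y fx≢fy → differ⇒1≤ x y (λ x≡y → fx≢fy (cong f x≡y))
  }

-- The feasible set is compact, so classically this infimum is a minimum.
EC : ∀ {n} → BooleanFunction n → ℝ≥0 (lsuc 0ℓ)
EC f = inf (FeasibleWeights f) (allOnes f) weightValue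

------------------------------------------------------------------------
-- Randomized query complexity

data DecisionTree (n : ℕ) : Set where
  output : Bool → DecisionTree n
  query  : (i : Fin n) (if0 if1 : DecisionTree n) → DecisionTree n

eval : ∀ {n} → DecisionTree n → Cube n → Bool
eval (output b)        x = b
eval (query i if0 if1) x = if lookup x i then eval if1 x else eval if0 x

queries : ∀ {n} → DecisionTree n → Cube n → ℕ
queries (output b)        x = 0
queries (query i if0 if1) x =
  suc (if lookup x i then queries if1 x else queries if0 x)

-- A finite sample space of random strings loses no generality: a tree that
-- never repeats a query is one of finitely many, and deleting repeated
-- queries changes no output and only lowers the cost.
record RandomizedAlgorithm (n : ℕ) : Set₁ where
  field
    size    : ℕ
    prob    : Fin size → ℝ≥0 0ℓ
    prob-Σ≈1 : sum prob ≈ 1ℝ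
    tree    : Fin size → DecisionTree n

  expectedQueries : Cube n → ℝ≥0 0ℓ
  expectedQueries x = sum λ r → prob r * fromℕ (queries (tree r) x)

  Pr[output≡_on_] : Bool → Cube n → ℝ≥0 0ℓ
  Pr[output≡ b on x ] =
    sum λ r → if does (eval (tree r) x Bool.≟ b) then prob r else 0ℝ

record ZeroErrorAlgorithm {n} (f : BooleanFunction n) : Set₁ where
  field
    algorithm : RandomizedAlgorithm n
  open RandomizedAlgorithm algorithm public
  field
    zero-error : ∀ x → Pr[output≡ f x on x ] ≈ 1ℝ

worstCaseCost : ∀ {n} {f : BooleanFunction n} → ZeroErrorAlgorithm f → ℝ≥0 0ℓ
worstCaseCost A = maxOverCube (ZeroErrorAlgorithm.expectedQueries A)

queryThen : ∀ {n k} → Vec (Fin n) k → BooleanFunction k → DecisionTree n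
queryThen []       g = output (g [])
queryThen (i ∷ is) g =
  query i (queryThen is (λ x → g (false ∷ x)))
          (queryThen is (λ x → g (true ∷ x)))

eval-queryThen : ∀ {n k} (is : Vec (Fin n) k) g (x : Cube n) →
                 eval (queryThen is g) x ≡ g (mapᵛ (lookup x) is)
eval-queryThen []       g x = refl
eval-queryThen (i ∷ is) g x with lookup x i
... | false = eval-queryThen is (λ y → g (false ∷ y)) x
... | true  = eval-queryThen is (λ y → g (true ∷ y)) x

1+0≈1 : (1ℝ + 0ℝ) ≈ 1ℝ
1+0≈1 = ≤₁ , x≤x+y 1ℝ 0ℝ
  where
  ≤₁ : 1ℝ + 0ℝ ≤ 1ℝ
  ≤₁ {q} 1<q with r , 1<r , r<q ← ℚ.<-dense 1<q =
    r , q ℚ.- r , 1<r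
    , subst (ℚ._< q ℚ.- r) (ℚ.+-inverseʳ r) (ℚ.+-monoˡ-< (ℚ.- r) r<q)
    , ℚ.≤-reflexive eq
    where
    eq : r ℚ.+ (q ℚ.- r) ≡ q
    eq = trans (ℚ.+-comm r (q ℚ.- r))
           (trans (ℚ.+-assoc q (ℚ.- r) r)
             (trans (cong (q ℚ.+_) (ℚ.+-inverseˡ r)) (ℚ.+-identityʳ q)))

queryAll : ∀ {n} (f : BooleanFunction n) → ZeroErrorAlgorithm f
queryAll {n} f = record
  { algorithm  = record
    { size     = 1
    ; prob     = λ _ → 1ℝ
    ; prob-Σ≈1 = 1+0≈1
    ; tree     = λ _ → queryThen (allFin n) f
    }
  ; zero-error = correct
  }
  where
  correct : ∀ x →
    ((if does (eval (queryThen (allFin n) f) x Bool.≟ f x) then 1ℝ else 0ℝ) + 0ℝ)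
      ≈ 1ℝ
  correct x with eval (queryThen (allFin n) f) x Bool.≟ f x
  ... | yes _ = 1+0≈1
  ... | no ≢  = ⊥-elim (≢ (trans (eval-queryThen (allFin n) f x)
                                 (cong f (map-lookup-allFin x))))

-- Optimising over distributions on the finitely many repetition-free trees
-- is a linear program, so classically this infimum is a minimum.
R₀ : ∀ {n} → BooleanFunction n → ℝ≥0 (lsuc 0ℓ)
R₀ f = inf (ZeroErrorAlgorithm f) (queryAll f) worstCaseCost

{-# OPTIONS --safe #-}

-- Lower bound: the visit probabilities w_x(i) = Pr[i is queried on x] are
-- feasible.  If the paths of two trees on x and y never read different values at
-- a common position, both paths are followed on a single input; when
-- f x ≠ f y one of the two trees then errs, so it has probability zero.
--
-- Upper bound: while f is not constant on the current subcube, pick y₀, y₁ in it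
-- with f y₀ ≠ f y₁ and query one position, drawn from the even mixture of w_y₀
-- and w_y₁, each normalised.  The input x has a value different from one of the
-- two, so the constraint makes the weight of w_x on the unqueried positions drop
-- by at least 1/(2 EC f) in expectation.  That weight is at most EC f at the
-- start, hence at most 2 (EC f)² queries are expected.

module Submission where

open import Defs
open import Level using (0ℓ)
open import Data.Nat.Base using (ℕ) renaming (_≥_ to _ℕ≥_)
open import Data.Product.Base using (Σ-syntax; _×_)

open import Algebra.Bundles using (CommutativeMonoid; CommutativeRing)
import Algebra.Properties.CommutativeMonoid.Sum as CommutativeMonoidSum
import Algebra.Properties.Semiring.Sum as SemiringSum
open import Data.Bool.Base using (Bool; true; false; if_then_else_; _∨_)
import Data.Bool.Properties as Bool
open import Data.Fin.Base using (Fin; zero; suc; punchIn)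
import Data.Fin.Properties as Fin
open import Data.Integer.Base as ℤ using (+_)
import Data.Integer.Properties as ℤ
open import Data.List.Base as List using (List; []; _∷_; _++_; length)
open import Data.Nat.Base using (zero; suc)
open import Data.Product.Base using (∃-syntax; _,_; proj₁; proj₂)
open import Data.Rational.Base as ℚ using (ℚ; 0ℚ; 1ℚ)
import Data.Rational.Properties as ℚ
import Data.Rational.Unnormalised.Base as ℚᵘ
import Data.Rational.Unnormalised.Properties as ℚᵘ
open import Data.Rational.Solver using (module +-*-Solver)
open import Data.Sum.Base using (_⊎_; inj₁; inj₂)
open import Data.Vec.Base using (Vec; []; _∷_; lookup; tabulate; insertAt; removeAt; replicate)
open import Data.Vec.Properties
  using (lookup∘tabulate; insertAt-lookup; insertAt-punchIn; insertAt-removeAt)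
open import Function.Base using (_∘_)
open import Relation.Binary.Bundles using (Poset)
open import Relation.Binary.PropositionalEquality
  using (_≡_; _≢_; refl; sym; trans; cong; cong₂; subst; module ≡-Reasoning)
import Relation.Binary.Reasoning.PartialOrder as PosetReasoning
open import Relation.Nullary using (¬_; Dec; yes; no; does; contradiction)
open import Relation.Nullary.Decidable using (_×-dec_; ¬?; dec-true; dec-false)

private variable
  n : ℕ
  x x′ y y′ z : ℝ≥0 0ℓ

-- Rational arithmetic

toℚ : ℕ → ℚ
toℚ k = + k ℚ./ 1

toℚ-suc : ∀ k → toℚ (suc k) ≡ 1ℚ ℚ.+ toℚ k
toℚ-suc k = ℚ.toℚᵘ-injective (begin
  ℚ.toℚᵘ (toℚ (suc k))           ≈⟨ ℚ.toℚᵘ-fromℚᵘ (ℚᵘ.mkℚᵘ (+ suc k) 0) ⟩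
  ℚᵘ.mkℚᵘ (+ suc k) 0            ≈⟨ ℚᵘ.*≡* (cong (λ i → (+ 1 ℤ.+ i) ℤ.* (+ 1))
                                       (sym (ℤ.*-identityʳ (+ k)))) ⟩
  ℚᵘ.1ℚᵘ ℚᵘ.+ ℚᵘ.mkℚᵘ (+ k) 0     ≈⟨ ℚᵘ.+-congʳ ℚᵘ.1ℚᵘ (ℚ.toℚᵘ-fromℚᵘ (ℚᵘ.mkℚᵘ (+ k) 0)) ⟨
  ℚᵘ.1ℚᵘ ℚᵘ.+ ℚ.toℚᵘ (toℚ k)      ≈⟨ ℚ.toℚᵘ-homo-+ 1ℚ (toℚ k) ⟨
  ℚ.toℚᵘ (1ℚ ℚ.+ toℚ k)           ∎)
  where open ℚᵘ.≃-Reasoning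

*-toℚ-suc : ∀ p k → p ℚ.* toℚ (suc k) ≡ p ℚ.+ p ℚ.* toℚ k
*-toℚ-suc p k = trans (cong (p ℚ.*_) (toℚ-suc k))
  (trans (ℚ.*-distribˡ-+ p 1ℚ (toℚ k)) (cong (ℚ._+ p ℚ.* toℚ k) (ℚ.*-identityʳ p)))

p+[q-p]≡q : ∀ p q → p ℚ.+ (q ℚ.- p) ≡ q
p+[q-p]≡q = solve 2 (λ p q → p :+ (q :- p) := q) refl
  where open +-*-Solver

[p+q]-p≡q : ∀ p q → p ℚ.+ q ℚ.- p ≡ q
[p+q]-p≡q = solve 2 (λ p q → p :+ q :- p := q) refl
  where open +-*-Solver

r*s≡r+r*[s-1] : ∀ r s → r ℚ.* s ≡ r ℚ.+ r ℚ.* (s ℚ.- 1ℚ)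
r*s≡r+r*[s-1] = solve 2 (λ r s → r :* s := r :+ r :* (s :- con 1ℚ)) refl
  where open +-*-Solver

p<q⇒0<q-p : ∀ {p q} → p ℚ.< q → 0ℚ ℚ.< q ℚ.- p
p<q⇒0<q-p {p} {q} p<q =
  subst (ℚ._< q ℚ.- p) (ℚ.+-inverseʳ p) (ℚ.+-monoˡ-< (ℚ.- p) p<q)

p+q<r⇒q<r-p : ∀ p {q r} → p ℚ.+ q ℚ.< r → q ℚ.< r ℚ.- p
p+q<r⇒q<r-p p {q} {r} p+q<r =
  subst (ℚ._< r ℚ.- p) ([p+q]-p≡q p q)
    (ℚ.+-monoˡ-< (ℚ.- p) p+q<r)

*-monoˡ-≤ : ∀ {p q} r → 0ℚ ℚ.≤ r → p ℚ.≤ q → p ℚ.* r ℚ.≤ q ℚ.* r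
*-monoˡ-≤ r 0≤r = ℚ.*-monoʳ-≤-nonNeg r {{ℚ.nonNegative 0≤r}}

*-monoʳ-≤ : ∀ {p q} r → 0ℚ ℚ.≤ r → p ℚ.≤ q → r ℚ.* p ℚ.≤ r ℚ.* q
*-monoʳ-≤ r 0≤r = ℚ.*-monoˡ-≤-nonNeg r {{ℚ.nonNegative 0≤r}}

0≤p*q : ∀ {p q} → 0ℚ ℚ.≤ p → 0ℚ ℚ.≤ q → 0ℚ ℚ.≤ p ℚ.* q
0≤p*q {p} {q} 0≤p 0≤q = subst (ℚ._≤ p ℚ.* q) (ℚ.*-zeroˡ q) (*-monoˡ-≤ q 0≤q 0≤p)

p≤q+p : ∀ p {q} → 0ℚ ℚ.≤ q → p ℚ.≤ q ℚ.+ p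
p≤q+p p {q} 0≤q = subst (ℚ._≤ q ℚ.+ p) (ℚ.+-identityˡ p) (ℚ.+-monoˡ-≤ p 0≤q)

+-cancelˡ-≤ : ∀ r {p q} → r ℚ.+ p ℚ.≤ r ℚ.+ q → p ℚ.≤ q
+-cancelˡ-≤ r {p} {q} h = ℚ.≮⇒≥ λ q<p →
  ℚ.<-irrefl refl (ℚ.<-≤-trans (ℚ.+-monoʳ-< r q<p) h)

-- Weight `w` of the queried position and weight `s` of the others recombine into the full weight;
-- `p` is the probability of the query and `b` the price in queries per unit of weight.
collect : ∀ b p w s → b ℚ.* (p ℚ.* w) ℚ.+ p ℚ.* (1ℚ ℚ.+ b ℚ.* s) ≡
          p ℚ.* (1ℚ ℚ.+ b ℚ.* (w ℚ.+ s))
collect = solve 4 (λ b p w s → b :* (p :* w) :+ p :* (con 1ℚ :+ b :* s) :=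
          p :* (con 1ℚ :+ b :* (w :+ s))) refl
  where open +-*-Solver

divide : ∀ {q s} → 0ℚ ℚ.< q → 0ℚ ℚ.< s → ∃[ r ] (0ℚ ℚ.< r × r ℚ.* s ≡ q)
divide {q} {s} 0<q 0<s =
  q ℚ.* ℚ.1/ s ,
  ℚ.positive⁻¹ (q ℚ.* ℚ.1/ s) {{ℚ.pos*pos⇒pos q (ℚ.1/ s)}} ,
  trans (ℚ.*-assoc q (ℚ.1/ s) s)
    (trans (cong (q ℚ.*_) (ℚ.*-inverseˡ s)) (ℚ.*-identityʳ q))
  where instance
    q-pos = ℚ.positive 0<q
    s-pos = ℚ.positive 0<s
    s-nonZero = ℚ.pos⇒nonZero s
    1/s-pos = ℚ.1/pos⇒pos s

-- Ordered semiring laws for nonnegative reals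

-- Two approximations of one real, coming from two occurrences of it, are replaced by a single one
-- that serves both.
lower : ∀ {ℓ} (x : ℝ≥0 ℓ) → ∀ {s t} → cut x s → cut x t →
        ∃[ u ] (cut x u × u ℚ.≤ s × u ℚ.≤ t)
lower x {s} {t} xs xt with ℚ.≤-total s t
... | inj₁ s≤t = s , xs , ℚ.≤-refl , s≤t
... | inj₂ t≤s = t , xt , t≤s , ℚ.≤-refl

infix 4 _≼_ _≃_

-- A record, unlike _≤_, lets Agda infer x and y from the relation.
record _≼_ (x y : ℝ≥0 0ℓ) : Set where
  constructor ≤⇒≼
  field ≼⇒≤ : x ≤ y
open _≼_

_≃_ : ℝ≥0 0ℓ → ℝ≥0 0ℓ → Set
x ≃ y = x ≼ y × y ≼ x

≼-refl : x ≼ x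
≼-refl = ≤⇒≼ λ h → h

≼-trans : x ≼ y → y ≼ z → x ≼ z
≼-trans p q = ≤⇒≼ λ h → ≼⇒≤ p (≼⇒≤ q h)

≃-sym : x ≃ y → y ≃ x
≃-sym (p , q) = q , p

≼-poset : Poset _ _ _
≼-poset = record
  { Carrier = ℝ≥0 0ℓ
  ; _≈_ = _≃_
  ; _≤_ = _≼_
  ; isPartialOrder = record
    { isPreorder = record
      { isEquivalence = record
        { refl  = ≼-refl , ≼-refl
        ; sym   = ≃-sym
        ; trans = λ (p , q) (r , s) → ≼-trans p r , ≼-trans s q
        }
      ; reflexive = proj₁
      ; trans = ≼-trans
      }
    ; antisym = _,_
    }
  }

infixl 6 _⊕_
infixl 7 _⊗_

-- The operations of ℝ≥0 are defined by copatterns, so the type checker compares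
-- two sums field by field, proofs included.  Opaque copies keep them folded.
opaque
  _⊕_ _⊗_ : ℝ≥0 0ℓ → ℝ≥0 0ℓ → ℝ≥0 0ℓ
  _⊕_ = _+_
  _⊗_ = _*_

  𝟘 𝟙 : ℝ≥0 0ℓ
  𝟘 = 0ℝ
  𝟙 = 1ℝ

opaque
  unfolding _⊕_

  0≼ : 𝟘 ≼ x
  0≼ {x} = ≤⇒≼ (positive x)

  +-mono-≼ : x ≼ x′ → y ≼ y′ → x ⊕ y ≼ x′ ⊕ y′
  +-mono-≼ p q = ≤⇒≼ λ (r , s , xr , ys , h) → r , s , ≼⇒≤ p xr , ≼⇒≤ q ys , h

  +-comm-≼ : ∀ x y → x ⊕ y ≼ y ⊕ x
  +-comm-≼ x y = ≤⇒≼ λ {q} (r , s , yr , xs , h) →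
    s , r , xs , yr , subst (ℚ._≤ q) (ℚ.+-comm r s) h

  +-assoc-≼ : ∀ x y z → (x ⊕ y) ⊕ z ≼ x ⊕ (y ⊕ z)
  +-assoc-≼ x y z = ≤⇒≼ λ {q} (r , m , xr , (s , t , ys , zt , s+t≤m) , r+m≤q) →
    r ℚ.+ s , t , (r , s , xr , ys , ℚ.≤-refl) , zt ,
    ℚ.≤-trans (ℚ.≤-reflexive (ℚ.+-assoc r s t))
      (ℚ.≤-trans (ℚ.+-monoʳ-≤ r s+t≤m) r+m≤q)

  +-assoc-≽ : ∀ x y z → x ⊕ (y ⊕ z) ≼ (x ⊕ y) ⊕ z
  +-assoc-≽ x y z = ≤⇒≼ λ {q} (m , t , (r , s , xr , ys , r+s≤m) , zt , m+t≤q) →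
    r , s ℚ.+ t , xr , (s , t , ys , zt , ℚ.≤-refl) ,
    ℚ.≤-trans (ℚ.≤-reflexive (sym (ℚ.+-assoc r s t)))
      (ℚ.≤-trans (ℚ.+-monoˡ-≤ t r+s≤m) m+t≤q)

  +-identityˡ-≃ : ∀ x → 𝟘 ⊕ x ≃ x
  +-identityˡ-≃ x = ≤⇒≼ below , ≤⇒≼ (y≤x+y 𝟘 x)
    where
    below : 𝟘 ⊕ x ≤ x
    -- Roundedness leaves a gap `q - p > 0`, which becomes the share of zero.
    below {q} xq with p , p<q , xp ← x .rounded xq =
      q ℚ.- p , p , p<q⇒0<q-p p<q , xp ,
      ℚ.≤-reflexive (trans (ℚ.+-comm (q ℚ.- p) p) (p+[q-p]≡q p q))

  x≼x⊕y : ∀ x y → x ≼ x ⊕ y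
  x≼x⊕y x y = ≤⇒≼ (x≤x+y x y)

  +-identityʳ-≃ : ∀ x → x ⊕ 𝟘 ≃ x
  +-identityʳ-≃ x = ≼-trans (+-comm-≼ x 𝟘) (proj₁ (+-identityˡ-≃ x)) , x≼x⊕y x 𝟘

  y≼x⊕y : ∀ x y → y ≼ x ⊕ y
  y≼x⊕y x y = ≤⇒≼ (y≤x+y x y)

+-0-commutativeMonoid : CommutativeMonoid _ _
+-0-commutativeMonoid = record
  { Carrier = ℝ≥0 0ℓ
  ; _≈_ = _≃_
  ; _∙_ = _⊕_
  ; ε = 𝟘
  ; isCommutativeMonoid = record
    { isMonoid = record
      { isSemigroup = record
        { isMagma = record
          { isEquivalence = Poset.Eq.isEquivalence ≼-poset
          ; ∙-cong = λ (p , q) (r , s) → +-mono-≼ p r , +-mono-≼ q s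
          }
        ; assoc = λ x y z → +-assoc-≼ x y z , +-assoc-≽ x y z
        }
      ; identity = +-identityˡ-≃ , +-identityʳ-≃
      }
    ; comm = λ x y → +-comm-≼ x y , +-comm-≼ y x
    }
  }

module ℝΣ = CommutativeMonoidSum +-0-commutativeMonoid
open ℝΣ using () renaming (sum to ∑)
module ≼-Reasoning = PosetReasoning ≼-poset

opaque
  unfolding _⊕_

  *-mono-≼ : x ≼ x′ → y ≼ y′ → x ⊗ y ≼ x′ ⊗ y′
  *-mono-≼ p q = ≤⇒≼ λ (r , s , xr , ys , h) → r , s , ≼⇒≤ p xr , ≼⇒≤ q ys , h

  *-comm-≼ : ∀ x y → x ⊗ y ≼ y ⊗ x
  *-comm-≼ x y = ≤⇒≼ λ {q} (r , s , yr , xs , h) →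
    s , r , xs , yr , subst (ℚ._≤ q) (ℚ.*-comm r s) h

  *-zeroˡ-≼ : ∀ x → 𝟘 ⊗ x ≼ 𝟘
  *-zeroˡ-≼ x = ≤⇒≼ λ {q} → below {q}
    where
    below : 𝟘 ⊗ x ≤ 𝟘
    below {q} 0<q
      with s , xs ← x .inhabited
      with r , 0<r , rs≡q ← divide 0<q (positive x xs) =
      r , s , 0<r , xs , ℚ.≤-reflexive rs≡q

  *-zeroʳ-≼ : ∀ x → x ⊗ 𝟘 ≼ 𝟘
  *-zeroʳ-≼ x = ≼-trans (*-comm-≼ x 𝟘) (*-zeroˡ-≼ x)

  *-distribʳ-≼ : ∀ z x y → (x ⊕ y) ⊗ z ≼ x ⊗ z ⊕ y ⊗ z
  *-distribʳ-≼ z x y = ≤⇒≼ below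
    where
    below : (x ⊕ y) ⊗ z ≤ x ⊗ z ⊕ y ⊗ z
    below {q} (m , m′ , (r , t , xr , zt , rt≤m) , (s , t′ , ys , zt′ , st′≤m′) , m+m′≤q)
      with u , zu , u≤t , u≤t′ ← lower z zt zt′ =
      r ℚ.+ s , u , (r , s , xr , ys , ℚ.≤-refl) , zu , (begin
        (r ℚ.+ s) ℚ.* u           ≡⟨ ℚ.*-distribʳ-+ u r s ⟩
        r ℚ.* u ℚ.+ s ℚ.* u       ≤⟨ ℚ.+-mono-≤
                                       (*-monoʳ-≤ r (ℚ.<⇒≤ (positive x xr)) u≤t)
                                       (*-monoʳ-≤ s (ℚ.<⇒≤ (positive y ys)) u≤t′) ⟩
        r ℚ.* t ℚ.+ s ℚ.* t′      ≤⟨ ℚ.+-mono-≤ rt≤m st′≤m′ ⟩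
        m ℚ.+ m′                  ≤⟨ m+m′≤q ⟩
        q                         ∎)
      where open ℚ.≤-Reasoning

  *-distribʳ-≽ : ∀ z x y → x ⊗ z ⊕ y ⊗ z ≼ (x ⊕ y) ⊗ z
  *-distribʳ-≽ z x y = ≤⇒≼ λ (m , t , (r , s , xr , ys , r+s≤m) , zt , mt≤q) →
    r ℚ.* t , s ℚ.* t , (r , t , xr , zt , ℚ.≤-refl) , (s , t , ys , zt , ℚ.≤-refl) ,
    ℚ.≤-trans (ℚ.≤-reflexive (sym (ℚ.*-distribʳ-+ t r s)))
      (ℚ.≤-trans (*-monoˡ-≤ t (ℚ.<⇒≤ (positive z zt)) r+s≤m) mt≤q)

  *-suc-≼ : ∀ x k → x ⊕ x ⊗ fromℕ k ≼ x ⊗ fromℕ (suc k)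
  *-suc-≼ x k = ≤⇒≼ λ {q} (r , s , xr , 1+k<s , rs≤q) →
    r , r ℚ.* (s ℚ.- 1ℚ) , xr ,
    (r , s ℚ.- 1ℚ , xr ,
      p+q<r⇒q<r-p 1ℚ (subst (ℚ._< s) (toℚ-suc k) 1+k<s) , ℚ.≤-refl) ,
    subst (ℚ._≤ q) (r*s≡r+r*[s-1] r s) rs≤q

  1≼1*1 : 𝟙 ≼ 𝟙 ⊗ 𝟙
  1≼1*1 = ≤⇒≼ 1≤1*1

  -- One-sided cuts have no subtraction, so each `q > 0` is tested separately: `1 + q` bounds a
  -- share above 1 plus a share for `x`, and the latter is then below `q`.
  1+x≼1⇒x≼0 : 𝟙 ⊕ x ≼ 𝟙 → x ≼ 𝟘
  1+x≼1⇒x≼0 {x} h = ≤⇒≼ λ {q} → below {q}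
    where
    below : x ≤ 𝟘
    below {q} 0<q
      with r , s , 1<r , xs , r+s≤1+q ←
        ≼⇒≤ h (subst (ℚ._< 1ℚ ℚ.+ q) (ℚ.+-identityʳ 1ℚ) (ℚ.+-monoʳ-< 1ℚ 0<q)) =
      upward x (ℚ.<⇒≤ s<q) xs
      where
      s<q : s ℚ.< q
      s<q = ℚ.≰⇒> λ q≤s →
        ℚ.<-irrefl refl (ℚ.<-≤-trans (ℚ.+-mono-<-≤ 1<r q≤s) r+s≤1+q)

-- Finite sums and products of sums

∑-mono-≼ : {t u : Fin n → ℝ≥0 0ℓ} → (∀ i → t i ≼ u i) → ∑ t ≼ ∑ u
∑-mono-≼ {zero}  h = ≼-refl
∑-mono-≼ {suc n} h = +-mono-≼ (h zero) (∑-mono-≼ (h ∘ suc))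

term≼∑ : (t : Fin n → ℝ≥0 0ℓ) (i : Fin n) → t i ≼ ∑ t
term≼∑ t zero    = x≼x⊕y (t zero) (∑ (t ∘ suc))
term≼∑ t (suc i) = ≼-trans (term≼∑ (t ∘ suc) i) (y≼x⊕y (t zero) (∑ (t ∘ suc)))

*-distribʳ-∑ : (t : Fin n → ℝ≥0 0ℓ) (x : ℝ≥0 0ℓ) →
               ∑ t ⊗ x ≃ ∑ (λ i → t i ⊗ x)
*-distribʳ-∑ {zero}  t x = *-zeroˡ-≼ x , 0≼
*-distribʳ-∑ {suc n} t x =
  ≼-trans (*-distribʳ-≼ x (t zero) (∑ (t ∘ suc)))
    (+-mono-≼ ≼-refl (proj₁ (*-distribʳ-∑ (t ∘ suc) x))) ,
  ≼-trans (+-mono-≼ ≼-refl (proj₂ (*-distribʳ-∑ (t ∘ suc) x)))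
    (*-distribʳ-≽ x (t zero) (∑ (t ∘ suc)))

*-distribˡ-∑ : (x : ℝ≥0 0ℓ) (t : Fin n → ℝ≥0 0ℓ) →
               x ⊗ ∑ t ≃ ∑ (λ i → x ⊗ t i)
*-distribˡ-∑ x t =
  ≼-trans (*-comm-≼ x (∑ t))
    (≼-trans (proj₁ (*-distribʳ-∑ t x)) (∑-mono-≼ λ i → *-comm-≼ (t i) x)) ,
  ≼-trans (∑-mono-≼ λ i → *-comm-≼ x (t i))
    (≼-trans (proj₂ (*-distribʳ-∑ t x)) (*-comm-≼ (∑ t) x))

∑-*-∑ : ∀ {m n} (t : Fin m → ℝ≥0 0ℓ) (u : Fin n → ℝ≥0 0ℓ) →
        ∑ t ⊗ ∑ u ≃ ∑ λ i → ∑ λ j → t i ⊗ u j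
∑-*-∑ t u =
  ≼-trans (proj₁ (*-distribʳ-∑ t (∑ u)))
    (∑-mono-≼ λ i → proj₁ (*-distribˡ-∑ (t i) u)) ,
  ≼-trans (∑-mono-≼ λ i → proj₂ (*-distribˡ-∑ (t i) u))
    (proj₂ (*-distribʳ-∑ t (∑ u)))

-- Cuts of maxima over the cube

cut-maxOverCube⁻ : ∀ {v : Cube n → ℝ≥0 0ℓ} {q} →
                   cut (maxOverCube v) q → ∀ x → cut (v x) q
cut-maxOverCube⁻ h       []          = h
cut-maxOverCube⁻ (h , _) (false ∷ x) = cut-maxOverCube⁻ h x
cut-maxOverCube⁻ (_ , h) (true ∷ x)  = cut-maxOverCube⁻ h x

cut-maxOverCube⁺ : ∀ {v : Cube n → ℝ≥0 0ℓ} {q} →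
                   (∀ x → cut (v x) q) → cut (maxOverCube v) q
cut-maxOverCube⁺ {zero}  h = h []
cut-maxOverCube⁺ {suc n} h =
  cut-maxOverCube⁺ (h ∘ (false ∷_)) , cut-maxOverCube⁺ (h ∘ (true ∷_))

-- Visit probabilities as weights

visits : DecisionTree n → Cube n → Fin n → Bool
visits (output b)        x i = false
visits (query j if0 if1) x i =
  does (i Fin.≟ j) ∨ (if lookup x j then visits if1 x i else visits if0 x i)

-- Induction along the path: agreement at the root position sends `z` and `x` into the same child,
-- and what is visited there is visited by the whole tree.
eval-local : ∀ (t : DecisionTree n) {x z} →
             (∀ i → visits t x i ≡ true → lookup z i ≡ lookup x i) →
             eval t z ≡ eval t x
eval-local (output b) agree = refl
eval-local (query j if0 if1) {x} {z} agree
  rewrite agree j (cong (_∨ (if lookup x j then visits if1 x j else visits if0 x j))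
      (dec-true (j Fin.≟ j) refl))
  with lookup x j
... | false = eval-local if0 λ i v → agree i
  (trans (cong (does (i Fin.≟ j) ∨_) v) (Bool.∨-zeroʳ _))
... | true  = eval-local if1 λ i v → agree i
  (trans (cong (does (i Fin.≟ j) ∨_) v) (Bool.∨-zeroʳ _))

Conflict : (s t : DecisionTree n) (x y : Cube n) → Fin n → Set
Conflict s t x y i =
  lookup x i ≢ lookup y i × visits s x i ≡ true × visits t y i ≡ true

conflict? : ∀ (s t : DecisionTree n) x y → Dec (∃[ i ] Conflict s t x y i)
conflict? s t x y = Fin.any? λ i →
  ¬? (lookup x i Bool.≟ lookup y i) ×-dec
  (visits s x i Bool.≟ true) ×-dec (visits t y i Bool.≟ true)

-- Paths of two trees that do not conflict are followed on a common input.
splice : ∀ (s t : DecisionTree n) x y → ¬ (∃[ i ] Conflict s t x y i) →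
         ∃[ z ] (eval s z ≡ eval s x × eval t z ≡ eval t y)
splice s t x y no-conflict = merged , eval-local s on-s , eval-local t on-t
  where
  merged = tabulate λ i → if visits s x i then lookup x i else lookup y i

  on-s : ∀ i → visits s x i ≡ true → lookup merged i ≡ lookup x i
  on-s i si = trans (lookup∘tabulate _ i) (cong (if_then lookup x i else lookup y i) si)

  on-t : ∀ i → visits t y i ≡ true → lookup merged i ≡ lookup y i
  on-t i ti with visits s x i in si
  ... | false = trans (lookup∘tabulate _ i) (cong (if_then lookup x i else lookup y i) si)
  -- Both paths read `i`, so different values there would be a conflict.
  ... | true  with lookup x i Bool.≟ lookup y i
  ...   | yes xi≡yi = trans (on-s i si) xi≡yi
  ...   | no  xi≢yi = contradiction (i , xi≢yi , si , ti) no-conflict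

keep : Bool → ℝ≥0 0ℓ → ℝ≥0 0ℓ
keep b x = if b then x else 𝟘

keep≼ : ∀ b → keep b x ≼ x
keep≼ false = 0≼
keep≼ true  = ≼-refl

-- This is the union bound; it is not an equality, since both flags may be set.
keep-∨ : ∀ b c → keep (b ∨ c) x ≼ keep b x ⊕ keep c x
keep-∨ {x} false c = y≼x⊕y 𝟘 (keep c x)
keep-∨ {x} true  c = x≼x⊕y x (keep c x)

∑-zero : ∀ n → ∑ {n} (λ _ → 𝟘) ≼ 𝟘
∑-zero n = proj₁ (ℝΣ.sum-replicate-zero n)

∑-keep-≟ : ∀ (j : Fin n) → ∑ (λ i → keep (does (i Fin.≟ j)) x) ≼ x
∑-keep-≟ {suc n} {x} zero = ≼-trans (+-mono-≼ ≼-refl (∑-zero n)) (proj₁ (+-identityʳ-≃ x))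
∑-keep-≟ {suc n} {x} (suc j) = ≼-trans (proj₁ (+-identityˡ-≃ _)) (∑-keep-≟ j)

-- The root adds at most `p`, the followed child the rest. A position queried repeatedly counts once
-- on the left and every time on the right.
∑-visits : ∀ (t : DecisionTree n) x {p} →
           ∑ (λ i → keep (visits t x i) p) ≼ p ⊗ fromℕ (queries t x)
∑-visits {n} (output b) x = ≼-trans (∑-zero n) 0≼
∑-visits (query j if0 if1) x {p} = ≼-trans
  (∑-mono-≼ λ i → keep-∨ (does (i Fin.≟ j)) _)
  (≼-trans (proj₁ (ℝΣ.∑-distrib-+ (λ i → keep (does (i Fin.≟ j)) p) rest))
  (≼-trans (+-mono-≼ (∑-keep-≟ j) below)
  (*-suc-≼ p (if lookup x j then queries if1 x else queries if0 x))))
  where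
  rest = λ i → keep (if lookup x j then visits if1 x i else visits if0 x i) p

  below : ∑ rest ≼ p ⊗ fromℕ (if lookup x j then queries if1 x else queries if0 x)
  below with lookup x j
  ... | false = ∑-visits if0 x
  ... | true  = ∑-visits if1 x

module VisitWeights {f : BooleanFunction n} (A : ZeroErrorAlgorithm f) where
  open ZeroErrorAlgorithm A

  opaque
    unfolding _⊕_

    ∑prob≃1 : ∑ prob ≃ 𝟙
    ∑prob≃1 = ≤⇒≼ (proj₁ prob-Σ≈1) , ≤⇒≼ (proj₂ prob-Σ≈1)

    1≼∑right : ∀ x → 𝟙 ≼ ∑ λ r → keep (does (eval (tree r) x Bool.≟ f x)) (prob r)
    1≼∑right x = ≤⇒≼ (proj₂ (zero-error x))

  -- The trees that are right on `x` already have total mass 1, and a wrong tree adds its mass to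
  -- theirs within a total of 1.
  wrong⇒prob≼0 : ∀ r x → eval (tree r) x ≢ f x → prob r ≼ 𝟘
  wrong⇒prob≼0 r x wrong = 1+x≼1⇒x≼0 (begin
    𝟙 ⊕ prob r             ≤⟨ +-mono-≼ (1≼∑right x) (≼-trans r-rejected (term≼∑ rejected r)) ⟩
    ∑ kept ⊕ ∑ rejected    ≈⟨ ℝΣ.∑-distrib-+ kept rejected ⟨
    ∑ (λ s → kept s ⊕ rejected s)
                           ≤⟨ ∑-mono-≼ {size} (λ s → split (right s)) ⟩
    ∑ prob                 ≈⟨ ∑prob≃1 ⟩
    𝟙                      ∎)
    where
    open ≼-Reasoning
    right : Fin size → Bool
    right s = does (eval (tree s) x Bool.≟ f x)

    kept rejected : Fin size → ℝ≥0 0ℓ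
    kept s = keep (right s) (prob s)
    rejected s = if right s then 𝟘 else prob s

    split : ∀ b {p} → keep b p ⊕ (if b then 𝟘 else p) ≼ p
    split true  {p} = proj₁ (+-identityʳ-≃ p)
    split false {p} = proj₁ (+-identityˡ-≃ p)

    r-rejected : prob r ≼ rejected r
    r-rejected rewrite dec-false (eval (tree r) x Bool.≟ f x) wrong = ≼-refl

  weight : Cube n → Fin n → ℝ≥0 0ℓ
  weight x i = ∑ λ r → keep (visits (tree r) x i) (prob r)

  weight≼1 : ∀ x i → weight x i ≼ 𝟙
  weight≼1 x i = ≼-trans (∑-mono-≼ {size} λ r → keep≼ (visits (tree r) x i)) (proj₁ ∑prob≃1)

  ∑-weight : ∀ x → ∑ (weight x) ≼ ∑ λ r → prob r ⊗ fromℕ (queries (tree r) x)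
  ∑-weight x = ≼-trans
    (proj₁ (ℝΣ.∑-comm λ i r → keep (visits (tree r) x i) (prob r)))
    (∑-mono-≼ {size} λ r → ∑-visits (tree r) x)

  module _ (x y : Cube n) (fx≢fy : f x ≢ f y) where

    -- These are the terms of `weight x i ⊗ weight y i`, expanded over pairs of trees and kept only
    -- where `x` and `y` differ.
    contribution : Fin size → Fin size → Fin n → ℝ≥0 0ℓ
    contribution r s i = if does (lookup x i Bool.≟ lookup y i) then 𝟘
      else keep (visits (tree r) x i) (prob r) ⊗ keep (visits (tree s) y i) (prob s)

    -- At a conflict a single position contributes the whole product. Without one, both trees follow
    -- their paths on a common `z`; since `f x ≢ f y`, the answers on `x`, `z` and `y` cannot all be
    -- right, so one of the two probabilities vanishes.
    pair-≼ : ∀ r s → prob r ⊗ prob s ≼ ∑ (contribution r s)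
    pair-≼ r s with conflict? (tree r) (tree s) x y
    ... | yes (i , xi≢yi , ri , si) = ≼-trans at-i (term≼∑ (contribution r s) i)
      where
      at-i : prob r ⊗ prob s ≼ contribution r s i
      at-i rewrite dec-false (lookup x i Bool.≟ lookup y i) xi≢yi | ri | si = ≼-refl
    ... | no no-conflict
      with z , rz , sz ← splice (tree r) (tree s) x y no-conflict
      with eval (tree r) x Bool.≟ f x | eval (tree r) z Bool.≟ f z
         | eval (tree s) z Bool.≟ f z | eval (tree s) y Bool.≟ f y
    ... | no wrong | _ | _ | _ =
      ≼-trans (*-mono-≼ (wrong⇒prob≼0 r x wrong) ≼-refl) (≼-trans (*-zeroˡ-≼ (prob s)) 0≼)
    ... | yes _ | no wrong | _ | _ =
      ≼-trans (*-mono-≼ (wrong⇒prob≼0 r z wrong) ≼-refl) (≼-trans (*-zeroˡ-≼ (prob s)) 0≼)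
    ... | yes _ | yes _ | no wrong | _ =
      ≼-trans (*-mono-≼ ≼-refl (wrong⇒prob≼0 s z wrong)) (≼-trans (*-zeroʳ-≼ (prob r)) 0≼)
    ... | yes _ | yes _ | yes _ | no wrong =
      ≼-trans (*-mono-≼ ≼-refl (wrong⇒prob≼0 s y wrong)) (≼-trans (*-zeroʳ-≼ (prob r)) 0≼)
    ... | yes rx≡ | yes rz≡ | yes sz≡ | yes sy≡ =
      contradiction
        (trans (sym rx≡) (trans (sym rz) (trans rz≡ (trans (sym sz≡) (trans sz sy≡)))))
        fx≢fy

    position-≼ : ∀ i → ∑ (λ r → ∑ λ s → contribution r s i) ≼
      (if does (lookup x i Bool.≟ lookup y i) then 𝟘 else weight x i ⊗ weight y i)
    position-≼ i with does (lookup x i Bool.≟ lookup y i)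
    ... | true  = ≼-trans (∑-mono-≼ {size} λ r → ∑-zero size) (∑-zero size)
    ... | false = proj₂ (∑-*-∑
      (λ r → keep (visits (tree r) x i) (prob r))
      (λ s → keep (visits (tree s) y i) (prob s)))

    -- The square of the total probability is a sum over pairs of trees; each pair is charged to
    -- positions, and exchanging the sums collects the charges by position.
    1≼∑-contribution : 𝟙 ≼
      ∑ λ i → if does (lookup x i Bool.≟ lookup y i) then 𝟘 else weight x i ⊗ weight y i
    1≼∑-contribution = begin
      𝟙                                            ≤⟨ 1≼1*1 ⟩
      𝟙 ⊗ 𝟙                                        ≤⟨ *-mono-≼ (proj₂ ∑prob≃1) (proj₂ ∑prob≃1) ⟩
      ∑ prob ⊗ ∑ prob                              ≈⟨ ∑-*-∑ prob prob ⟩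
      ∑ (λ r → ∑ λ s → prob r ⊗ prob s)            ≤⟨ ∑-mono-≼ (λ r → ∑-mono-≼ (pair-≼ r)) ⟩
      ∑ (λ r → ∑ λ s → ∑ (contribution r s))       ≤⟨ ∑-mono-≼ (λ r → proj₁ (ℝΣ.∑-comm (contribution r))) ⟩
      ∑ (λ r → ∑ λ i → ∑ λ s → contribution r s i) ≈⟨ ℝΣ.∑-comm (λ r i → ∑ λ s → contribution r s i) ⟩
      ∑ (λ i → ∑ λ r → ∑ λ s → contribution r s i) ≤⟨ ∑-mono-≼ position-≼ ⟩
      ∑ (λ i → if does (lookup x i Bool.≟ lookup y i) then 𝟘 else weight x i ⊗ weight y i) ∎
      where open ≼-Reasoning

  opaque
    unfolding _⊕_

    feasibleWeights : FeasibleWeights f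
    feasibleWeights = record
      { w          = weight
      ; w≤1        = λ x i → ≼⇒≤ (weight≼1 x i)
      ; intersects = λ x y fx≢fy → ≼⇒≤ (1≼∑-contribution x y fx≢fy)
      }

    weightValue≤worstCaseCost : weightValue feasibleWeights ≤ worstCaseCost A
    weightValue≤worstCaseCost h =
      cut-maxOverCube⁺ λ x → ≼⇒≤ (∑-weight x) (cut-maxOverCube⁻ h x)

EC≤R₀ : (f : BooleanFunction n) → EC f ≤ R₀ f
EC≤R₀ f (A , h) = feasibleWeights , weightValue≤worstCaseCost h
  where open VisitWeights A

-- Finite distributions with rational weights

module ℚΣ = SemiringSum (CommutativeRing.semiring ℚ.+-*-commutativeRing)
open ℚΣ using () renaming (sum to ∑ᵠ)

∑ᵠ-mono-≤ : {t u : Fin n → ℚ} → (∀ i → t i ℚ.≤ u i) → ∑ᵠ t ℚ.≤ ∑ᵠ u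
∑ᵠ-mono-≤ {zero}  h = ℚ.≤-refl
∑ᵠ-mono-≤ {suc n} h = ℚ.+-mono-≤ (h zero) (∑ᵠ-mono-≤ (h ∘ suc))

0≤∑ᵠ : {t : Fin n → ℚ} → (∀ i → 0ℚ ℚ.≤ t i) → 0ℚ ℚ.≤ ∑ᵠ t
0≤∑ᵠ {zero}  h = ℚ.≤-refl
0≤∑ᵠ {suc n} h = ℚ.+-mono-≤ (h zero) (0≤∑ᵠ (h ∘ suc))

record Weighted (A : Set) : Set where
  constructor weighted
  field
    mass   : ℚ
    0≤mass : 0ℚ ℚ.≤ mass
    value  : A
open Weighted

-- Total mass is not part of the type. It is the expectation of the constant 1 and is tracked
-- separately where it has to be 1.
Distribution : Set → Set
Distribution A = List (Weighted A)

private variable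
  A B : Set

expect : (A → ℚ) → Distribution A → ℚ
expect g []      = 0ℚ
expect g (w ∷ d) = mass w ℚ.* g (value w) ℚ.+ expect g d

scale : ∀ p → 0ℚ ℚ.≤ p → Weighted A → Weighted A
scale p 0≤p (weighted m 0≤m a) = weighted (p ℚ.* m) (0≤p*q 0≤p 0≤m) a

infixl 1 _>>=_

_>>=_ : Distribution A → (A → Distribution B) → Distribution B
[]      >>= k = []
(w ∷ d) >>= k = List.map (scale (mass w) (0≤mass w)) (k (value w)) ++ (d >>= k)

return : A → Distribution A
return a = weighted 1ℚ (ℚ.nonNegative⁻¹ 1ℚ) a ∷ []

draw : (p : Fin n → ℚ) → (∀ i → 0ℚ ℚ.≤ p i) → Distribution (Fin n)
draw p 0≤p = List.tabulate λ i → weighted (p i) (0≤p i) i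

module _ (g : A → ℚ) where

  expect-++ : ∀ d e → expect g (d ++ e) ≡ expect g d ℚ.+ expect g e
  expect-++ []      e = sym (ℚ.+-identityˡ _)
  expect-++ (w ∷ d) e = trans (cong (mass w ℚ.* g (value w) ℚ.+_) (expect-++ d e))
    (sym (ℚ.+-assoc (mass w ℚ.* g (value w)) (expect g d) (expect g e)))

  expect-scale : ∀ p 0≤p d → expect g (List.map (scale p 0≤p) d) ≡ p ℚ.* expect g d
  expect-scale p 0≤p []      = sym (ℚ.*-zeroʳ p)
  expect-scale p 0≤p (w ∷ d) = trans
    (cong₂ ℚ._+_ (ℚ.*-assoc p (mass w) (g (value w))) (expect-scale p 0≤p d))
    (sym (ℚ.*-distribˡ-+ p (mass w ℚ.* g (value w)) (expect g d)))

  expect->>= : ∀ (d : Distribution B) (k : B → Distribution A) →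
               expect g (d >>= k) ≡ expect (λ b → expect g (k b)) d
  expect->>= []      k = refl
  expect->>= (w ∷ d) k = trans
    (expect-++ (List.map (scale (mass w) (0≤mass w)) (k (value w))) (d >>= k))
    (cong₂ ℚ._+_ (expect-scale (mass w) (0≤mass w) (k (value w))) (expect->>= d k))

  expect-return : ∀ a → expect g (return a) ≡ g a
  expect-return a = trans (ℚ.+-identityʳ _) (ℚ.*-identityˡ (g a))

  -- Passes from lists to the sums over `Fin` in which the cost of a `RandomizedAlgorithm` is
  -- expressed.
  expect-lookup : ∀ d → expect g d ≡
    ∑ᵠ λ r → mass (List.lookup d r) ℚ.* g (value (List.lookup d r))
  expect-lookup []      = refl
  expect-lookup (w ∷ d) = cong (mass w ℚ.* g (value w) ℚ.+_) (expect-lookup d)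

expect-tabulate : (g : A → ℚ) (w : Fin n → Weighted A) →
                  expect g (List.tabulate w) ≡ ∑ᵠ λ i → mass (w i) ℚ.* g (value (w i))
expect-tabulate {n = zero}  g w = refl
expect-tabulate {n = suc n} g w =
  cong (mass (w zero) ℚ.* g (value (w zero)) ℚ.+_) (expect-tabulate g (w ∘ suc))

expect-cong : ∀ {g h : A → ℚ} → (∀ a → g a ≡ h a) → ∀ d → expect g d ≡ expect h d
expect-cong g≗h []      = refl
expect-cong g≗h (w ∷ d) = cong₂ (λ u v → mass w ℚ.* u ℚ.+ v) (g≗h (value w)) (expect-cong g≗h d)

expect-affine : ∀ c (g : A → ℚ) d →
  expect (λ a → c ℚ.+ g a) d ≡ expect (λ _ → 1ℚ) d ℚ.* c ℚ.+ expect g d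
expect-affine c g []      = sym (trans (ℚ.+-identityʳ _) (ℚ.*-zeroˡ c))
expect-affine c g (w ∷ d) = trans
  (cong (mass w ℚ.* (c ℚ.+ g (value w)) ℚ.+_) (expect-affine c g d))
  (rearrange (mass w) c (g (value w)) (expect (λ _ → 1ℚ) d) (expect g d))
  where
  rearrange : ∀ m c u k v → m ℚ.* (c ℚ.+ u) ℚ.+ (k ℚ.* c ℚ.+ v)
            ≡ (m ℚ.* 1ℚ ℚ.+ k) ℚ.* c ℚ.+ (m ℚ.* u ℚ.+ v)
  rearrange = solve 5 (λ m c u k v → m :* (c :+ u) :+ (k :* c :+ v)
            := (m :* con 1ℚ :+ k) :* c :+ (m :* u :+ v)) refl
    where open +-*-Solver

expect-1+ : ∀ (g : A → ℚ) d → expect (λ _ → 1ℚ) d ≡ 1ℚ →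
            expect (λ a → 1ℚ ℚ.+ g a) d ≡ 1ℚ ℚ.+ expect g d
expect-1+ g d total = trans (expect-affine 1ℚ g d)
  (cong (ℚ._+ expect g d) (trans (ℚ.*-identityʳ _) total))

expect-const : ∀ c (d : Distribution A) → expect (λ _ → 1ℚ) d ≡ 1ℚ →
               expect (λ _ → c) d ≡ c
expect-const {A} c d total = trans (scaled d) (trans (cong (ℚ._* c) total) (ℚ.*-identityˡ c))
  where
  scaled : ∀ (d : Distribution A) → expect (λ _ → c) d ≡ expect (λ _ → 1ℚ) d ℚ.* c
  scaled []      = sym (ℚ.*-zeroˡ c)
  scaled (w ∷ d) = trans
    (cong₂ ℚ._+_ (cong (ℚ._* c) (sym (ℚ.*-identityʳ (mass w)))) (scaled d))
    (sym (ℚ.*-distribʳ-+ c (mass w ℚ.* 1ℚ) (expect (λ _ → 1ℚ) d)))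

-- Decision trees on subcubes

-- A subcube is encoded as a cube of smaller dimension: the fixed coordinate is deleted. The
-- recursion is then on the dimension, and no position is queried twice.
restrict : {C : Set} → Fin (suc n) → Bool → (Cube (suc n) → C) → Cube n → C
restrict i b g z = g (insertAt z i b)

lookup-removeAt : ∀ (x : Cube (suc n)) i j → lookup (removeAt x i) j ≡ lookup x (punchIn i j)
lookup-removeAt x i j = trans (sym (insertAt-punchIn (removeAt x i) i (lookup x i) j))
  (cong (λ z → lookup z (punchIn i j)) (insertAt-removeAt x i))

weaken : Fin (suc n) → DecisionTree n → DecisionTree (suc n)
weaken i (output b)        = output b
weaken i (query j if0 if1) = query (punchIn i j) (weaken i if0) (weaken i if1)

eval-weaken : ∀ i (t : DecisionTree n) x → eval (weaken i t) x ≡ eval t (removeAt x i)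
eval-weaken i (output b)        x = refl
eval-weaken i (query j if0 if1) x
  rewrite lookup-removeAt x i j | eval-weaken i if0 x | eval-weaken i if1 x = refl

queries-weaken : ∀ i (t : DecisionTree n) x →
                 queries (weaken i t) x ≡ queries t (removeAt x i)
queries-weaken i (output b)        x = refl
queries-weaken i (query j if0 if1) x
  rewrite lookup-removeAt x i j | queries-weaken i if0 x | queries-weaken i if1 x = refl

insertAt-removeAt′ : ∀ (x : Cube (suc n)) i {b} → lookup x i ≡ b → insertAt (removeAt x i) i b ≡ x
insertAt-removeAt′ x i refl = insertAt-removeAt x i

-- Correctness travels with each tree, so zero error holds for every outcome of the sampling.
TreeFor : BooleanFunction n → Set
TreeFor {n} g = Σ[ t ∈ DecisionTree n ] (∀ x → eval t x ≡ g x)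

branch : ∀ {g : BooleanFunction (suc n)} i →
         TreeFor (restrict i false g) → TreeFor (restrict i true g) → TreeFor g
branch {g = g} i (t₀ , t₀≗) (t₁ , t₁≗) = query i (weaken i t₀) (weaken i t₁) , correct
  where
  correct : ∀ x → eval (query i (weaken i t₀) (weaken i t₁)) x ≡ g x
  correct x with lookup x i in xi
  ... | false = trans (eval-weaken i t₀ x)
                  (trans (t₀≗ (removeAt x i)) (cong g (insertAt-removeAt′ x i xi)))
  ... | true  = trans (eval-weaken i t₁ x)
                  (trans (t₁≗ (removeAt x i)) (cong g (insertAt-removeAt′ x i xi)))

constant-or-not : (g : BooleanFunction n) →
  (∃[ b ] (∀ x → b ≡ g x)) ⊎ (∃[ y₀ ] ∃[ y₁ ] g y₀ ≢ g y₁)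
constant-or-not {zero}  g = inj₁ (g [] , λ { [] → refl })
constant-or-not {suc n} g
  with constant-or-not (g ∘ (false ∷_)) | constant-or-not (g ∘ (true ∷_))
... | inj₂ (y₀ , y₁ , ≢) | _                  = inj₂ (false ∷ y₀ , false ∷ y₁ , ≢)
... | inj₁ _             | inj₂ (y₀ , y₁ , ≢) = inj₂ (true ∷ y₀ , true ∷ y₁ , ≢)
... | inj₁ (b₀ , g≡b₀)   | inj₁ (b₁ , g≡b₁) with b₀ Bool.≟ b₁
...   | yes refl = inj₁ (b₀ , λ { (false ∷ x) → g≡b₀ x ; (true ∷ x) → g≡b₁ x })
...   | no b₀≢b₁ = inj₂ (false ∷ zeros , true ∷ zeros ,
                     λ eq → b₀≢b₁ (trans (g≡b₀ zeros) (trans eq (sym (g≡b₁ zeros)))))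
  where
  zeros = replicate n false

sumWhereDifferᵠ : Cube n → Cube n → (Fin n → ℚ) → ℚ
sumWhereDifferᵠ x y t =
  ∑ᵠ λ i → if does (lookup x i Bool.≟ lookup y i) then 0ℚ else t i

-- Sampling queries from rational weights

-- Rational upper approximations of a feasible family. Strict positivity makes the row sums nonzero
-- in positive dimension, so that rows can be normalised.
record RationalWeights (g : BooleanFunction n) (a : ℚ) : Set where
  field
    v          : Cube n → Fin n → ℚ
    0<v        : ∀ x i → 0ℚ ℚ.< v x i
    ∑v≤a       : ∀ x → ∑ᵠ (v x) ℚ.≤ a
    intersects : ∀ x y → g x ≢ g y →
                 1ℚ ℚ.≤ sumWhereDifferᵠ x y (λ i → v x i ℚ.* v y i)
open RationalWeights

-- Points of the subcube agree at `i`, so deleting `i` leaves the constraint sums unchanged; row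
-- sums only decrease.
restrictWeights : ∀ {g : BooleanFunction (suc n)} {a} → RationalWeights g a →
                  ∀ i b → RationalWeights (restrict i b g) a
restrictWeights {n} {g} {a} W i b = record
  { v          = v′
  ; 0<v        = λ z j → 0<v W (insertAt z i b) (punchIn i j)
  ; ∑v≤a       = λ z → ℚ.≤-trans
      (subst (∑ᵠ (v′ z) ℚ.≤_)
        (sym (ℚΣ.sum-remove {i = i} (v W (insertAt z i b))))
        (p≤q+p _ (ℚ.<⇒≤ (0<v W (insertAt z i b) i))))
      (∑v≤a W (insertAt z i b))
  ; intersects = λ z z′ gz≢gz′ → subst (1ℚ ℚ.≤_) (same z z′)
      (intersects W (insertAt z i b) (insertAt z′ i b) gz≢gz′)
  }
  where
  v′ : Cube n → Fin n → ℚ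
  v′ z j = v W (insertAt z i b) (punchIn i j)

  same : ∀ z z′ →
    sumWhereDifferᵠ (insertAt z i b) (insertAt z′ i b)
      (λ k → v W (insertAt z i b) k ℚ.* v W (insertAt z′ i b) k) ≡
    sumWhereDifferᵠ z z′ (λ j → v′ z j ℚ.* v′ z′ j)
  same z z′ = trans (ℚΣ.sum-remove {i = i} term)
    (trans (cong₂ ℚ._+_ at-i (ℚΣ.sum-cong-≗ at-punchIn)) (ℚ.+-identityˡ _))
    where
    term : Fin (suc n) → ℚ
    term k = if does (lookup (insertAt z i b) k Bool.≟ lookup (insertAt z′ i b) k) then 0ℚ
      else v W (insertAt z i b) k ℚ.* v W (insertAt z′ i b) k

    at-i : term i ≡ 0ℚ
    at-i rewrite dec-true (lookup (insertAt z i b) i Bool.≟ lookup (insertAt z′ i b) i)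
      (trans (insertAt-lookup z i b) (sym (insertAt-lookup z′ i b))) = refl

    at-punchIn : ∀ j → term (punchIn i j) ≡
      (if does (lookup z j Bool.≟ lookup z′ j) then 0ℚ else v′ z j ℚ.* v′ z′ j)
    at-punchIn j rewrite insertAt-punchIn z i b j | insertAt-punchIn z′ i b j = refl

2ℚ : ℚ
2ℚ = 1ℚ ℚ.+ 1ℚ

-- The bound depends on the input so that the remaining weight of `x` can serve as a potential in
-- the recursion.
record Sampler (g : BooleanFunction n) (bound : Cube n → ℚ) : Set where
  field
    trees : Distribution (TreeFor g)
    total : expect (λ _ → 1ℚ) trees ≡ 1ℚ
    cost  : ∀ x → expect (λ t → toℚ (queries (proj₁ t) x)) trees ℚ.≤ bound x
open Sampler

-- Querying i with probability P i costs one query and lowers Σ v_x, in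
-- expectation, by at least 1/2a.
module Step {g : BooleanFunction (suc n)} {a : ℚ} (W : RationalWeights g a)
            (y₀ y₁ : Cube (suc n)) (g-differs : g y₀ ≢ g y₁) where

  0≤v : ∀ x i → 0ℚ ℚ.≤ v W x i
  0≤v x i = ℚ.<⇒≤ (0<v W x i)

  0≤a : 0ℚ ℚ.≤ a
  0≤a = ℚ.≤-trans (0≤∑ᵠ (0≤v y₀)) (∑v≤a W y₀)

  -- The scaled row of `y` has sum one half, so the scaled rows of `y₀` and `y₁` together form a
  -- probability distribution.
  rate : (y : Cube (suc n)) → ∃[ c ] (0ℚ ℚ.< c × c ℚ.* ∑ᵠ (v W y) ≡ ℚ.½)
  rate y = divide (ℚ.positive⁻¹ ℚ.½)
    (ℚ.+-mono-<-≤ (0<v W y zero) (0≤∑ᵠ (0≤v y ∘ suc)))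

  c : Cube (suc n) → ℚ
  c y = proj₁ (rate y)

  0≤c : ∀ y → 0ℚ ℚ.≤ c y
  0≤c y = ℚ.<⇒≤ (proj₁ (proj₂ (rate y)))

  P : Fin (suc n) → ℚ
  P i = c y₀ ℚ.* v W y₀ i ℚ.+ c y₁ ℚ.* v W y₁ i

  0≤P : ∀ i → 0ℚ ℚ.≤ P i
  0≤P i = ℚ.+-mono-≤ (0≤p*q (0≤c y₀) (0≤v y₀ i)) (0≤p*q (0≤c y₁) (0≤v y₁ i))

  ∑P≡1 : ∑ᵠ P ≡ 1ℚ
  ∑P≡1 = begin
    ∑ᵠ P
      ≡⟨ ℚΣ.∑-distrib-+ (λ i → c y₀ ℚ.* v W y₀ i) (λ i → c y₁ ℚ.* v W y₁ i) ⟩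
    ∑ᵠ (λ i → c y₀ ℚ.* v W y₀ i) ℚ.+ ∑ᵠ (λ i → c y₁ ℚ.* v W y₁ i)
      ≡⟨ cong₂ ℚ._+_ (ℚΣ.*-distribˡ-sum (c y₀) (v W y₀)) (ℚΣ.*-distribˡ-sum (c y₁) (v W y₁)) ⟨
    c y₀ ℚ.* ∑ᵠ (v W y₀) ℚ.+ c y₁ ℚ.* ∑ᵠ (v W y₁)
      ≡⟨ cong₂ ℚ._+_ (proj₂ (proj₂ (rate y₀))) (proj₂ (proj₂ (rate y₁))) ⟩
    ℚ.½ ℚ.+ ℚ.½
      ≡⟨ refl ⟩
    1ℚ ∎
    where open ≡-Reasoning

  -- All positions count, also those where `y` and `x` agree, because querying `i` removes `v W x i`
  -- from the remaining weight whatever the value read.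
  common : Cube (suc n) → Cube (suc n) → ℚ
  common y x = ∑ᵠ λ i → v W y i ℚ.* v W x i

  0≤common : ∀ y x → 0ℚ ℚ.≤ common y x
  0≤common y x = 0≤∑ᵠ λ i → 0≤p*q (0≤v y i) (0≤v x i)

  1≤common : ∀ y x → g y ≢ g x → 1ℚ ℚ.≤ common y x
  1≤common y x gy≢gx = ℚ.≤-trans (intersects W y x gy≢gx)
    (∑ᵠ-mono-≤ λ i → drop (does (lookup y i Bool.≟ lookup x i)) (0≤p*q (0≤v y i) (0≤v x i)))
    where
    drop : ∀ b {p} → 0ℚ ℚ.≤ p → (if b then 0ℚ else p) ℚ.≤ p
    drop true  0≤p = 0≤p
    drop false 0≤p = ℚ.≤-refl

  -- The row sum of `y` is at most `a`, so the scaling factor `c y` is at least 1/(2a); the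
  -- constraint bounds the other factor below by 1.
  ½≤ : ∀ y x → g y ≢ g x → ℚ.½ ℚ.≤ a ℚ.* (c y ℚ.* common y x)
  ½≤ y x gy≢gx = begin
    ℚ.½                            ≡⟨ proj₂ (proj₂ (rate y)) ⟨
    c y ℚ.* ∑ᵠ (v W y)             ≤⟨ *-monoʳ-≤ (c y) (0≤c y) (∑v≤a W y) ⟩
    c y ℚ.* a                      ≡⟨ ℚ.*-comm (c y) a ⟩
    a ℚ.* c y                      ≡⟨ cong (a ℚ.*_) (ℚ.*-identityʳ (c y)) ⟨
    a ℚ.* (c y ℚ.* 1ℚ)             ≤⟨ *-monoʳ-≤ a 0≤a (*-monoʳ-≤ (c y) (0≤c y) (1≤common y x gy≢gx)) ⟩
    a ℚ.* (c y ℚ.* common y x)    ∎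
    where open ℚ.≤-Reasoning

  0≤share : ∀ y x → 0ℚ ℚ.≤ a ℚ.* (c y ℚ.* common y x)
  0≤share y x = 0≤p*q 0≤a (0≤p*q (0≤c y) (0≤common y x))

  -- As `g y₀` and `g y₁` differ, at least one of them differs from `g x`; the share of the other is
  -- nonnegative.
  ½≤both : ∀ x → ℚ.½ ℚ.≤ a ℚ.* (c y₀ ℚ.* common y₀ x) ℚ.+ a ℚ.* (c y₁ ℚ.* common y₁ x)
  ½≤both x with g y₀ Bool.≟ g x
  ... | no gy₀≢gx = ℚ.+-mono-≤ (½≤ y₀ x gy₀≢gx) (0≤share y₁ x)
  ... | yes gy₀≡gx = ℚ.+-mono-≤ (0≤share y₀ x)
    (½≤ y₁ x λ gy₁≡gx → g-differs (trans gy₀≡gx (sym gy₁≡gx)))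

  -- The sum is the expected weight removed by one query. Multiplying by `2a` states the drop of
  -- 1/(2a) without division.
  gain : ∀ x → 1ℚ ℚ.≤ 2ℚ ℚ.* a ℚ.* ∑ᵠ (λ i → P i ℚ.* v W x i)
  gain x = begin
    1ℚ
      ≡⟨⟩
    2ℚ ℚ.* ℚ.½
      ≤⟨ *-monoʳ-≤ 2ℚ (ℚ.nonNegative⁻¹ 2ℚ) (½≤both x) ⟩
    2ℚ ℚ.* (a ℚ.* (c y₀ ℚ.* common y₀ x) ℚ.+ a ℚ.* (c y₁ ℚ.* common y₁ x))
      ≡⟨ cong (2ℚ ℚ.*_) (ℚ.*-distribˡ-+ a _ _) ⟨
    2ℚ ℚ.* (a ℚ.* (c y₀ ℚ.* common y₀ x ℚ.+ c y₁ ℚ.* common y₁ x))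
      ≡⟨ ℚ.*-assoc 2ℚ a _ ⟨
    2ℚ ℚ.* a ℚ.* (c y₀ ℚ.* common y₀ x ℚ.+ c y₁ ℚ.* common y₁ x)
      ≡⟨ cong (2ℚ ℚ.* a ℚ.*_) (cong₂ ℚ._+_ (pull y₀) (pull y₁)) ⟩
    2ℚ ℚ.* a ℚ.* (∑ᵠ (part y₀) ℚ.+ ∑ᵠ (part y₁))
      ≡⟨ cong (2ℚ ℚ.* a ℚ.*_) (ℚΣ.∑-distrib-+ (part y₀) (part y₁)) ⟨
    2ℚ ℚ.* a ℚ.* ∑ᵠ (λ i → part y₀ i ℚ.+ part y₁ i)
      ≡⟨ cong (2ℚ ℚ.* a ℚ.*_) (ℚΣ.sum-cong-≗ λ i →
           ℚ.*-distribʳ-+ (v W x i) (c y₀ ℚ.* v W y₀ i) (c y₁ ℚ.* v W y₁ i)) ⟨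
    2ℚ ℚ.* a ℚ.* ∑ᵠ (λ i → P i ℚ.* v W x i)
      ∎
    where
    open ℚ.≤-Reasoning
    part : Cube (suc n) → Fin (suc n) → ℚ
    part y i = c y ℚ.* v W y i ℚ.* v W x i

    pull : ∀ y → c y ℚ.* common y x ≡ ∑ᵠ (part y)
    pull y = trans (ℚΣ.*-distribˡ-sum (c y) (λ i → v W y i ℚ.* v W x i))
      (ℚΣ.sum-cong-≗ λ i → sym (ℚ.*-assoc (c y) (v W y i) (v W x i)))

  module _ (S : ∀ i b → Sampler (restrict i b g)
                  (λ z → 2ℚ ℚ.* a ℚ.* ∑ᵠ (v (restrictWeights W i b) z))) where

    -- Both children are drawn independently, although a given input follows only one of them.
    subtrees : (i : Fin (suc n)) → Distribution (TreeFor g)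
    subtrees i =
      trees (S i false) >>= λ t₀ →
      trees (S i true)  >>= λ t₁ →
      return (branch i t₀ t₁)

    expect-subtrees : ∀ i (h : TreeFor g → ℚ) → expect h (subtrees i) ≡
      expect (λ t₀ → expect (λ t₁ → h (branch i t₀ t₁)) (trees (S i true))) (trees (S i false))
    expect-subtrees i h = trans (expect->>= h (trees (S i false)) _)
      (expect-cong (λ t₀ → trans (expect->>= h (trees (S i true)) _)
        (expect-cong (λ t₁ → expect-return h (branch i t₀ t₁)) (trees (S i true))))
        (trees (S i false)))

    total-subtrees : ∀ i → expect (λ _ → 1ℚ) (subtrees i) ≡ 1ℚ
    total-subtrees i = trans (expect-subtrees i (λ _ → 1ℚ))
      (trans (expect-cong (λ t₀ → total (S i true)) (trees (S i false))) (total (S i false)))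

    subcube-cost : ∀ x i b → lookup x i ≡ b →
      expect (λ t → toℚ (suc (queries (weaken i (proj₁ t)) x))) (trees (S i b)) ℚ.≤
      1ℚ ℚ.+ 2ℚ ℚ.* a ℚ.* ∑ᵠ (λ j → v W x (punchIn i j))
    subcube-cost x i b xi = begin
      expect (λ t → toℚ (suc (queries (weaken i (proj₁ t)) x))) (trees (S i b))
        ≡⟨ expect-cong (λ t → trans (cong (λ k → toℚ (suc k)) (queries-weaken i (proj₁ t) x))
             (toℚ-suc (queries (proj₁ t) (removeAt x i)))) (trees (S i b)) ⟩
      expect (λ t → 1ℚ ℚ.+ toℚ (queries (proj₁ t) (removeAt x i))) (trees (S i b))
        ≡⟨ expect-1+ _ (trees (S i b)) (total (S i b)) ⟩
      1ℚ ℚ.+ expect (λ t → toℚ (queries (proj₁ t) (removeAt x i))) (trees (S i b))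
        ≤⟨ ℚ.+-monoʳ-≤ 1ℚ (cost (S i b) (removeAt x i)) ⟩
      1ℚ ℚ.+ 2ℚ ℚ.* a ℚ.* ∑ᵠ (λ j → v W (insertAt (removeAt x i) i b) (punchIn i j))
        ≡⟨ cong (λ z → 1ℚ ℚ.+ 2ℚ ℚ.* a ℚ.* ∑ᵠ (λ j → v W z (punchIn i j)))
             (insertAt-removeAt′ x i xi) ⟩
      1ℚ ℚ.+ 2ℚ ℚ.* a ℚ.* ∑ᵠ (λ j → v W x (punchIn i j))
        ∎
      where open ℚ.≤-Reasoning

    -- Only the child selected by the value at `i` is paid for. The cost is constant in the other
    -- child, whose total mass 1 integrates it out.
    cost-subtrees : ∀ x i →
      expect (λ t → toℚ (queries (proj₁ t) x)) (subtrees i) ℚ.≤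
      1ℚ ℚ.+ 2ℚ ℚ.* a ℚ.* ∑ᵠ (λ j → v W x (punchIn i j))
    cost-subtrees x i
      rewrite expect-subtrees i (λ t → toℚ (queries (proj₁ t) x))
      with lookup x i in xi
    ... | false = subst (ℚ._≤ _)
      (sym (expect-cong (λ t₀ → expect-const _ (trees (S i true)) (total (S i true)))
        (trees (S i false))))
      (subcube-cost x i false xi)
    ... | true  = subst (ℚ._≤ _)
      (sym (expect-const _ (trees (S i false)) (total (S i false))))
      (subcube-cost x i true xi)

    sampler : Sampler g (λ x → 2ℚ ℚ.* a ℚ.* ∑ᵠ (v W x))
    sampler = record
      { trees = draw P 0≤P >>= subtrees
      ; total = begin-equality
          expect (λ _ → 1ℚ) (draw P 0≤P >>= subtrees)  ≡⟨ expect-step (λ _ → 1ℚ) ⟩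
          ∑ᵠ (λ i → P i ℚ.* expect (λ _ → 1ℚ) (subtrees i))
            ≡⟨ ℚΣ.sum-cong-≗ (λ i → trans (cong (P i ℚ.*_) (total-subtrees i)) (ℚ.*-identityʳ (P i))) ⟩
          ∑ᵠ P                                         ≡⟨ ∑P≡1 ⟩
          1ℚ                                           ∎
      -- The added 1 is the price of the root query. `gain` pays for it, and at each `i` the weight
      -- removed and the weight remaining add up to the whole row sum.
      ; cost  = λ x → +-cancelˡ-≤ 1ℚ (begin
          1ℚ ℚ.+ expect (κ x) (draw P 0≤P >>= subtrees)
            ≤⟨ ℚ.+-monoˡ-≤ _ (gain x) ⟩
          2ℚ ℚ.* a ℚ.* ∑ᵠ (λ i → P i ℚ.* v W x i) ℚ.+ expect (κ x) (draw P 0≤P >>= subtrees)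
            ≡⟨ cong₂ ℚ._+_ (ℚΣ.*-distribˡ-sum (2ℚ ℚ.* a) (λ i → P i ℚ.* v W x i))
                 (expect-step (κ x)) ⟩
          ∑ᵠ (λ i → 2ℚ ℚ.* a ℚ.* (P i ℚ.* v W x i)) ℚ.+ ∑ᵠ (λ i → P i ℚ.* expect (κ x) (subtrees i))
            ≡⟨ ℚΣ.∑-distrib-+ (λ i → 2ℚ ℚ.* a ℚ.* (P i ℚ.* v W x i))
                              (λ i → P i ℚ.* expect (κ x) (subtrees i)) ⟨
          ∑ᵠ (λ i → 2ℚ ℚ.* a ℚ.* (P i ℚ.* v W x i) ℚ.+ P i ℚ.* expect (κ x) (subtrees i))
            ≤⟨ ∑ᵠ-mono-≤ (λ i → per-index x i) ⟩
          ∑ᵠ (λ i → P i ℚ.* (1ℚ ℚ.+ 2ℚ ℚ.* a ℚ.* ∑ᵠ (v W x)))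
            ≡⟨ ℚΣ.*-distribʳ-sum (1ℚ ℚ.+ 2ℚ ℚ.* a ℚ.* ∑ᵠ (v W x)) P ⟨
          ∑ᵠ P ℚ.* (1ℚ ℚ.+ 2ℚ ℚ.* a ℚ.* ∑ᵠ (v W x))
            ≡⟨ cong (ℚ._* (1ℚ ℚ.+ 2ℚ ℚ.* a ℚ.* ∑ᵠ (v W x))) ∑P≡1 ⟩
          1ℚ ℚ.* (1ℚ ℚ.+ 2ℚ ℚ.* a ℚ.* ∑ᵠ (v W x))
            ≡⟨ ℚ.*-identityˡ _ ⟩
          1ℚ ℚ.+ 2ℚ ℚ.* a ℚ.* ∑ᵠ (v W x)
            ∎)
      }
      where
      open ℚ.≤-Reasoning
      κ : Cube (suc n) → TreeFor g → ℚ
      κ x t = toℚ (queries (proj₁ t) x)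

      expect-step : ∀ h → expect h (draw P 0≤P >>= subtrees) ≡
                    ∑ᵠ λ i → P i ℚ.* expect h (subtrees i)
      expect-step h = trans (expect->>= h (draw P 0≤P) subtrees)
        (expect-tabulate (λ i → expect h (subtrees i)) (λ i → weighted (P i) (0≤P i) i))

      per-index : ∀ x i →
        2ℚ ℚ.* a ℚ.* (P i ℚ.* v W x i) ℚ.+ P i ℚ.* expect (κ x) (subtrees i) ℚ.≤
        P i ℚ.* (1ℚ ℚ.+ 2ℚ ℚ.* a ℚ.* ∑ᵠ (v W x))
      per-index x i = begin
        2ℚ ℚ.* a ℚ.* (P i ℚ.* v W x i) ℚ.+ P i ℚ.* expect (κ x) (subtrees i)
          ≤⟨ ℚ.+-monoʳ-≤ (2ℚ ℚ.* a ℚ.* (P i ℚ.* v W x i))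
               (*-monoʳ-≤ (P i) (0≤P i) (cost-subtrees x i)) ⟩
        2ℚ ℚ.* a ℚ.* (P i ℚ.* v W x i) ℚ.+
          P i ℚ.* (1ℚ ℚ.+ 2ℚ ℚ.* a ℚ.* ∑ᵠ (λ j → v W x (punchIn i j)))
          ≡⟨ collect (2ℚ ℚ.* a) (P i) (v W x i) _ ⟩
        P i ℚ.* (1ℚ ℚ.+ 2ℚ ℚ.* a ℚ.* (v W x i ℚ.+ ∑ᵠ (λ j → v W x (punchIn i j))))
          ≡⟨ cong (λ s → P i ℚ.* (1ℚ ℚ.+ 2ℚ ℚ.* a ℚ.* s)) (ℚΣ.sum-remove {i = i} (v W x)) ⟨
        P i ℚ.* (1ℚ ℚ.+ 2ℚ ℚ.* a ℚ.* ∑ᵠ (v W x))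
          ∎

-- The same `a` bounds the row sums on every subcube, so the factor `2ℚ ℚ.* a` stays fixed through
-- the recursion while the row sums shrink.
solve-by-weights : ∀ n {g : BooleanFunction n} {a} (W : RationalWeights g a) →
                   Sampler g (λ x → 2ℚ ℚ.* a ℚ.* ∑ᵠ (v W x))
solve-by-weights n {g} {a} W with constant-or-not g
... | inj₁ (b , b≡g) = record
  { trees = return (output b , b≡g)
  ; total = refl
  ; cost  = λ x → 0≤p*q (0≤p*q (ℚ.nonNegative⁻¹ 2ℚ) (0≤a x)) (0≤∑v x)
  }
  where
  0≤∑v : ∀ x → 0ℚ ℚ.≤ ∑ᵠ (v W x)
  0≤∑v x = 0≤∑ᵠ λ i → ℚ.<⇒≤ (0<v W x i)
  0≤a : Cube n → 0ℚ ℚ.≤ a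
  0≤a x = ℚ.≤-trans (0≤∑v x) (∑v≤a W x)
solve-by-weights zero    W | inj₂ ([] , [] , g-differs) = contradiction refl g-differs
solve-by-weights (suc n) W | inj₂ (y₀ , y₁ , g-differs) =
  Step.sampler W y₀ y₁ g-differs λ i b → solve-by-weights n (restrictWeights W i b)

-- Rational bounds on nonnegative reals

-- These express `x ≤ p` and `p ≤ x` through cuts, without the proof of nonnegativity that `fromℚ p`
-- would demand.
Upper Lower : ℝ≥0 0ℓ → ℚ → Set
Upper x p = ∀ {q} → p ℚ.< q → cut x q
Lower x p = ∀ {q} → cut x q → p ℚ.< q

-- Density divides the slack between the two summands, as the cut of a sum requires.
split-< : ∀ {u v q} → u ℚ.+ v ℚ.< q →
          ∃[ r ] ∃[ s ] (u ℚ.< r × v ℚ.< s × r ℚ.+ s ≡ q)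
split-< {u} {v} {q} u+v<q =
  split (ℚ.<-dense (p+q<r⇒q<r-p v (subst (ℚ._< q) (ℚ.+-comm u v) u+v<q)))
  where
  split : ∃[ r ] (u ℚ.< r × r ℚ.< q ℚ.- v) →
          ∃[ r ] ∃[ s ] (u ℚ.< r × v ℚ.< s × r ℚ.+ s ≡ q)
  split (r , u<r , r<q-v) = r , q ℚ.- r , u<r , p+q<r⇒q<r-p r r+v<q , p+[q-p]≡q r q
    where
    r+v<q : r ℚ.+ v ℚ.< q
    r+v<q = subst (r ℚ.+ v ℚ.<_) (trans (ℚ.+-comm (q ℚ.- v) v) (p+[q-p]≡q v q))
      (ℚ.+-monoˡ-< v r<q-v)

sum-Upper : {t : Fin n → ℝ≥0 0ℓ} {p : Fin n → ℚ} →
            (∀ i → Upper (t i) (p i)) → Upper (sum t) (∑ᵠ p)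
sum-Upper {zero}  h 0<q = 0<q
sum-Upper {suc n} {t} h ∑p<q =
  let r , s , p₀<r , ∑p<s , r+s≡q = split-< ∑p<q in
  r , s , h zero p₀<r , sum-Upper {t = t ∘ suc} (λ i → h (suc i)) ∑p<s , ℚ.≤-reflexive r+s≡q

sum-Lower : {t : Fin n → ℝ≥0 0ℓ} {p : Fin n → ℚ} →
            (∀ i → Lower (t i) (p i)) → Lower (sum t) (∑ᵠ p)
sum-Lower {zero}  h 0<q = 0<q
sum-Lower {suc n} {t} h (r , s , tr , ts , r+s≤q) =
  ℚ.<-≤-trans (ℚ.+-mono-< (h zero tr) (sum-Lower {t = t ∘ suc} (λ i → h (suc i)) ts)) r+s≤q

cut-sum⁻ : (t : Fin n → ℝ≥0 0ℓ) → ∀ {q} → cut (sum t) q →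
           Σ[ p ∈ (Fin n → ℚ) ] ((∀ i → cut (t i) (p i)) × ∑ᵠ p ℚ.≤ q)
cut-sum⁻ {zero}  t 0<q = (λ ()) , (λ ()) , ℚ.<⇒≤ 0<q
cut-sum⁻ {suc n} t (r , s , tr , ts , r+s≤q)
  with p , tp , ∑p≤s ← cut-sum⁻ (t ∘ suc) ts =
  (λ { zero → r ; (suc i) → p i }) ,
  (λ { zero → tr ; (suc i) → tp i }) ,
  ℚ.≤-trans (ℚ.+-monoʳ-≤ r ∑p≤s) r+s≤q

*-fromℕ-Upper : (x : ℝ≥0 0ℓ) → ∀ {p} → Upper x p → ∀ k → Upper (x * fromℕ k) (p ℚ.* toℚ k)
*-fromℕ-Upper x {p} xp zero {q} p0<q =
  let s , xs = x .inhabited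
      r , 0<r , rs≡q = divide (subst (ℚ._< q) (ℚ.*-zeroʳ p) p0<q) (positive x xs)
  in s , r , xs , 0<r , ℚ.≤-reflexive (trans (ℚ.*-comm s r) rs≡q)
*-fromℕ-Upper x {p} xp (suc k) {q} pk<q =
  let r , m , p<r , pk<m , r+m≡q = split-< (subst (ℚ._< q) (*-toℚ-suc p k) pk<q)
      r′ , s , xr′ , k<s , r′s≤m = *-fromℕ-Upper x xp k pk<m
      -- The first copy of `x` and the remaining `k` copies come with separate approximations; the
      -- product needs a common one.
      u , xu , u≤r , u≤r′ = lower x (xp p<r) xr′
      0≤s = ℚ.<⇒≤ (positive (fromℕ k) k<s)
  in
  u , 1ℚ ℚ.+ s , xu ,
  subst (ℚ._< 1ℚ ℚ.+ s) (sym (toℚ-suc k)) (ℚ.+-monoʳ-< 1ℚ k<s) , (begin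
    u ℚ.* (1ℚ ℚ.+ s)           ≡⟨ ℚ.*-distribˡ-+ u 1ℚ s ⟩
    u ℚ.* 1ℚ ℚ.+ u ℚ.* s       ≡⟨ cong (ℚ._+ u ℚ.* s) (ℚ.*-identityʳ u) ⟩
    u ℚ.+ u ℚ.* s              ≤⟨ ℚ.+-mono-≤ u≤r (*-monoˡ-≤ s 0≤s u≤r′) ⟩
    r ℚ.+ r′ ℚ.* s             ≤⟨ ℚ.+-monoʳ-≤ r r′s≤m ⟩
    r ℚ.+ m                    ≡⟨ r+m≡q ⟩
    q                          ∎)
  where open ℚ.≤-Reasoning

-- From weights to a zero-error algorithm

module _ {f : BooleanFunction n} where

  -- A rational in the cut of a row sum splits into rationals in the cuts of its terms. These lie
  -- above the weights, so the constraints survive.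
  rationalWeights : (W : FeasibleWeights f) → ∀ {a} → cut (weightValue W) a → RationalWeights f a
  rationalWeights W {a} h = record
    { v          = v′
    ; 0<v        = λ x i → positive (w x i) (w-v′ x i)
    ; ∑v≤a       = λ x → proj₂ (proj₂ (approx x))
    -- A rational sum below 1 would put 1 into the cut of the real sum, and feasibility would then
    -- give 1 < 1.
    ; intersects = λ x y fx≢fy → ℚ.≮⇒≥ λ ∑<1 →
        ℚ.<-irrefl refl (FeasibleWeights.intersects W x y fx≢fy
          (sum-Upper (upper x y) ∑<1))
    }
    where
    open FeasibleWeights W using (w)

    approx : ∀ x → Σ[ p ∈ (Fin n → ℚ) ] ((∀ i → cut (w x i) (p i)) × ∑ᵠ p ℚ.≤ a)
    approx x = cut-sum⁻ (w x) (cut-maxOverCube⁻ h x)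

    v′ : Cube n → Fin n → ℚ
    v′ x = proj₁ (approx x)

    w-v′ : ∀ x i → cut (w x i) (v′ x i)
    w-v′ x = proj₁ (proj₂ (approx x))

    upper : ∀ x y i →
      Upper (if does (lookup x i Bool.≟ lookup y i) then 0ℝ else w x i * w y i)
            (if does (lookup x i Bool.≟ lookup y i) then 0ℚ else v′ x i ℚ.* v′ y i)
    upper x y i {q} with does (lookup x i Bool.≟ lookup y i)
    ... | true  = λ 0<q → 0<q
    ... | false = λ vv<q → v′ x i , v′ y i , w-v′ x i , w-v′ y i , ℚ.<⇒≤ vv<q

  module FromSampler {bound : Cube n → ℚ} (S : Sampler f bound) where

    size : ℕ
    size = length (trees S)

    entry : Fin size → Weighted (TreeFor f)
    entry = List.lookup (trees S)

    prob : Fin size → ℝ≥0 0ℓ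
    prob r = fromℚ (mass (entry r)) {{ℚ.nonNegative (0≤mass (entry r))}}

    tree : Fin size → DecisionTree n
    tree r = proj₁ (value (entry r))

    ∑mass≡1 : ∑ᵠ (mass ∘ entry) ≡ 1ℚ
    ∑mass≡1 = trans
      (ℚΣ.sum-cong-≗ λ r → sym (ℚ.*-identityʳ (mass (entry r))))
      (trans (sym (expect-lookup (λ _ → 1ℚ) (trees S))) (total S))

    -- Stated for any terms equal to the masses, so that it covers both the total probability and
    -- the probability of a right answer.
    sum≈1 : (t : Fin size → ℝ≥0 0ℓ) →
            (∀ r → Upper (t r) (mass (entry r))) → (∀ r → Lower (t r) (mass (entry r))) →
            sum t ≈ 1ℝ
    sum≈1 t up low =
      (λ {q} 1<q → sum-Upper up (subst (ℚ._< q) (sym ∑mass≡1) 1<q)) ,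
      (λ {q} h → subst (ℚ._< q) ∑mass≡1 (sum-Lower low h))

    correct : ∀ x r → does (eval (tree r) x Bool.≟ f x) ≡ true
    correct x r = dec-true (eval (tree r) x Bool.≟ f x) (proj₂ (value (entry r)) x)

    algorithm : ZeroErrorAlgorithm f
    algorithm = record
      { algorithm  = record
        { size     = size
        ; prob     = prob
        ; prob-Σ≈1 = sum≈1 prob (λ r m<q → m<q) (λ r m<q → m<q)
        ; tree     = tree
        }
      ; zero-error = λ x → sum≈1 (λ r → if does (eval (tree r) x Bool.≟ f x) then prob r else 0ℝ)
          (λ r {q} → subst (λ b → mass (entry r) ℚ.< q → cut (if b then prob r else 0ℝ) q)
            (sym (correct x r)) (λ m<q → m<q))
          (λ r {q} → subst (λ b → cut (if b then prob r else 0ℝ) q → mass (entry r) ℚ.< q)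
            (sym (correct x r)) (λ m<q → m<q))
      }

    cost-Upper : ∀ x → Upper (ZeroErrorAlgorithm.expectedQueries algorithm x) (bound x)
    cost-Upper x {q} bound<q = sum-Upper
      (λ r → *-fromℕ-Upper (prob r) (λ m<q → m<q) (queries (tree r) x))
      (ℚ.≤-<-trans
        (subst (ℚ._≤ bound x) (expect-lookup (λ t → toℚ (queries (proj₁ t) x)) (trees S))
          (cost S x))
        bound<q)

2ℝ : ℝ≥0 0ℓ
2ℝ = fromℚ 2ℚ

R₀≤2*EC² : (f : BooleanFunction n) → R₀ f ≤ 2ℝ * (EC f * EC f)
R₀≤2*EC² {n} f {q} (r , s , 2<r , (b , c , (W , Wb) , (W′ , W′c) , bc≤s) , rs≤q) =
  -- The two factors `EC f` may be witnessed by different feasible families; the one with the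
  -- smaller bound is used for both.
  finish (lower (EC f) (W , Wb) (W′ , W′c))
  where
  finish : ∃[ a ] (cut (EC f) a × a ℚ.≤ b × a ℚ.≤ c) → cut (R₀ f) q
  finish (a , (V , Va) , a≤b , a≤c) = algorithm , cut-maxOverCube⁺ λ x → cost-Upper x (bound<q x)
    where
    weights = rationalWeights V Va
    open FromSampler (solve-by-weights n weights)

    0<a = positive (weightValue V) Va
    a² = a ℚ.* a

    0<a² : 0ℚ ℚ.< a²
    0<a² = ℚ.positive⁻¹ a² {{ℚ.pos*pos⇒pos a {{ℚ.positive 0<a}} a {{ℚ.positive 0<a}}}}

    bound<q : ∀ x → 2ℚ ℚ.* a ℚ.* ∑ᵠ (v weights x) ℚ.< q
    bound<q x = begin-strict
      2ℚ ℚ.* a ℚ.* ∑ᵠ (v weights x)  ≤⟨ *-monoʳ-≤ (2ℚ ℚ.* a)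
                                         (0≤p*q (ℚ.nonNegative⁻¹ 2ℚ) (ℚ.<⇒≤ 0<a)) (∑v≤a weights x) ⟩
      2ℚ ℚ.* a ℚ.* a                 ≡⟨ ℚ.*-assoc 2ℚ a a ⟩
      -- Membership in the cut is strict; the strictness comes from `2 < r` together with `a² > 0`.
      2ℚ ℚ.* a²                      <⟨ ℚ.*-monoˡ-<-pos a² {{ℚ.positive 0<a²}} 2<r ⟩
      r ℚ.* a²                       ≤⟨ *-monoʳ-≤ r 0≤r (ℚ.≤-trans a²≤bc bc≤s) ⟩
      r ℚ.* s                        ≤⟨ rs≤q ⟩
      q                              ∎
      where
      open ℚ.≤-Reasoning
      0≤r : 0ℚ ℚ.≤ r
      0≤r = ℚ.<⇒≤ (positive 2ℝ 2<r)
      a²≤bc : a² ℚ.≤ b ℚ.* c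
      a²≤bc = ℚ.≤-trans (*-monoˡ-≤ a (ℚ.<⇒≤ 0<a) a≤b)
        (*-monoʳ-≤ b (ℚ.<⇒≤ (positive (weightValue W) Wb)) a≤c)

theorem1 : Σ[ K ∈ ℝ≥0 0ℓ ] (0ℝ < K ×
    ((n : ℕ) → n ℕ≥ 1 → (f : BooleanFunction n) →
      EC f ≤ R₀ f × R₀ f ≤ K * (EC f * EC f)))
theorem1 = 2ℝ , (2ℚ , ℚ.positive⁻¹ 2ℚ , λ 2<q → 2<q) ,
  λ n _ f → EC≤R₀ f , R₀≤2*EC² f
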